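{- For every integer $n \ge 1$, $R(Q_3, Q_n) \le \frac{37}{16}n + \frac{39}{16}$.
   Context: $Q_k$ denotes the Boolean lattice of dimension $k$: the family of all subsets of a $k$-element ground set (e.g. $[k]=\{1,\dots,k\}$), ordered by inclusion. A subposet $Q'$ of a poset $Q$ is a copy of a poset $P$ if there is a bijection $f$ from $P$ to $Q'$ such that $x \le y$ in $P$ if and only if $f(x) \le f(y)$ in $Q$. For posets $P, P'$, the poset Ramsey number $R(P,P')$ is the smallest integer $N$ such that for every coloring of the elements of $Q_N$ in red and blue, there is a copy of $P$ all of whose elements are red or a copy of $P'$ all of whose elements are blue. -}

module Defs where

open import Data.Nat using (ℕ; _*_; _+_; _≤_)
open import Data.Bool using (Bool; true; false)
open import Data.Fin.Subset using (Subset; _⊆_)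
open import Data.Product using (Σ; _×_; ∃)
open import Data.Sum using (_⊎_)

BooleanLattice : ℕ → Set
BooleanLattice k = Subset k

-- A copy of Q_k inside Q_N: a map f with  x ⊆ y  iff  f x ⊆ f y.
-- (Such an f is automatically injective, hence a bijection onto its image.)
IsCopy : ∀ {k N} → (Subset k → Subset N) → Set
IsCopy f = ∀ x y → (x ⊆ y → f x ⊆ f y) × (f x ⊆ f y → x ⊆ y)

-- Colorings of Q_N: true = red, false = blue.
Coloring : ℕ → Set
Coloring N = Subset N → Bool

MonoCopy : ∀ {N} → Coloring N → Bool → ℕ → Set
MonoCopy {N} c b k =
  Σ (Subset k → Subset N) λ f → IsCopy f × (∀ x → c (f x) ≡ b)
  where open import Relation.Binary.PropositionalEquality using (_≡_)

RamseyProperty : ℕ → ℕ → ℕ → Set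
RamseyProperty k m N = (c : Coloring N) → MonoCopy c true k ⊎ MonoCopy c false m

-- R(Q_k, Q_m) ≤ B  (B a natural): some N ≤ B has the Ramsey property.
-- Since the property is monotone in N, this is equivalent to the least such N being ≤ B.
-- We state the rational bound multiplied by 16: 16 * N ≤ 37 n + 39.

-- Assume that a colouring of Q_N, N ≈ 37n/16, has neither a red Q₃ nor a blue Qₙ.
--
-- Write the ground set as X ∪ Y with |X| = n and try to embed Qₙ by Z ↦ Z ∪ S(Z) with S(Z) ⊆ Y, where Y is
-- spent in blocks of three elements, one block for each possible value of |Z ─ A|, A being the smallest red
-- subset of Z. A block fails only if all of its eight subsets are red, which is a red Q₃; so the
-- embedding fails only because Y is exhausted, which produces red A ⊆ B whose interval has dimension about
-- |Y| + |Y|/3 ≈ 7n/4.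
--
-- Inside [A, B] the remaining six vertices are sought as atoms A ∪ {y} ∪ U and coatoms. If three elements y
-- admit U of size at most 3n/8 then the coatoms exist, because each has to avoid one y and to contain only two
-- of the sets U, leaving n free elements. So few elements y admit a small U, and dually. For y, y′ that do
-- not, the same embedding started at A ∪ {y} and stopped at B ─ {y′} is blue for free on the low and the high
-- levels, and blocks of three suffice for the n/4 levels in between.
--
-- The additive constant requires a closer look at the roundings: three pairwise intersecting U of size u leave
-- one more element, and six elements y yield these or three disjoint U (Ramsey's R(3,3) = 6); and a
-- last block of two elements in the first step either succeeds or provides two coatoms at once.
module Submission where

open import Defs
open import Data.Bool using (Bool; true; false; not) renaming (_≟_ to _≟ᵇ_)
open import Data.Bool.Properties using (¬-not; not-injective)
open import Data.Empty using () renaming (⊥ to False)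
open import Data.Fin using (Fin; zero; suc; toℕ)
open import Data.Fin.Properties using (all?; any?)
open import Data.Fin.Subset
open import Data.Fin.Subset.Properties
open import Data.Nat using (ℕ; zero; suc; pred; _*_; _+_; _∸_; _≤_; _<_; z≤n; s≤s; _≤?_; _<?_)
open import Data.Nat.DivMod using (_/_; _divMod_; result)
open import Data.Nat.Properties
open import Data.Nat.Tactic.RingSolver using (solve-∀)
open import Data.Product using (Σ; _×_; _,_; proj₁; proj₂; ∃; ∃-syntax)
open import Data.Sum using (_⊎_; inj₁; inj₂; [_,_]′)
open import Data.Vec using ([]; _∷_; here; there)
open import Function using (_∘_; id)
open import Relation.Binary.PropositionalEquality
  using (_≡_; _≢_; refl; sym; trans; cong; cong₂; subst; subst₂)
open import Relation.Nullary using (¬_; Dec; yes; no; contradiction)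
open import Relation.Nullary.Decidable
  using (_×-dec_; _⊎-dec_; _→-dec_; ¬?; map′; decidable-stable; from-yes)

private
  variable
    k n N : ℕ

-- Finite sets

Disjoint : Subset N → Subset N → Set
Disjoint p q = ∀ {x} → x ∈ p → x ∉ q

∪-lub : ∀ (p q : Subset N) {r} → p ⊆ r → q ⊆ r → p ∪ q ⊆ r
∪-lub p q p⊆r q⊆r x∈p∪q = [ p⊆r , q⊆r ]′ (x∈p∪q⁻ p q x∈p∪q)

x∈p─q⇒x∉q : ∀ (p q : Subset N) {x} → x ∈ p ─ q → x ∉ q
x∈p─q⇒x∉q (_ ∷ p) (_ ∷ q)       (there x∈) (there x∈q) = x∈p─q⇒x∉q p q x∈ x∈q

∪-disjoint : ∀ (p q : Subset N) {r} → Disjoint r p → Disjoint r q → Disjoint r (p ∪ q)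
∪-disjoint p q r∥p r∥q x∈r x∈ = [ r∥p x∈r , r∥q x∈r ]′ (x∈p∪q⁻ p q x∈)

∁-involutive : ∀ (p : Subset N) → ∁ (∁ p) ≡ p
∁-involutive p = ⊆-antisym (λ x∈ → x∉∁p⇒x∈p (x∈∁p⇒x∉p x∈)) (λ x∈ → x∉p⇒x∈∁p (x∈p⇒x∉∁p x∈))

∣p∪q∣+∣p∩q∣≡∣p∣+∣q∣ : ∀ (p q : Subset N) → ∣ p ∪ q ∣ + ∣ p ∩ q ∣ ≡ ∣ p ∣ + ∣ q ∣
∣p∪q∣+∣p∩q∣≡∣p∣+∣q∣ [] [] = refl
∣p∪q∣+∣p∩q∣≡∣p∣+∣q∣ (outside ∷ p) (outside ∷ q) = ∣p∪q∣+∣p∩q∣≡∣p∣+∣q∣ p q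
∣p∪q∣+∣p∩q∣≡∣p∣+∣q∣ (inside  ∷ p) (outside ∷ q) = cong suc (∣p∪q∣+∣p∩q∣≡∣p∣+∣q∣ p q)
∣p∪q∣+∣p∩q∣≡∣p∣+∣q∣ (outside ∷ p) (inside  ∷ q) =
  trans (cong suc (∣p∪q∣+∣p∩q∣≡∣p∣+∣q∣ p q)) (sym (+-suc ∣ p ∣ ∣ q ∣))
∣p∪q∣+∣p∩q∣≡∣p∣+∣q∣ (inside  ∷ p) (inside  ∷ q) =
  cong suc (trans (+-suc ∣ p ∪ q ∣ ∣ p ∩ q ∣)
           (trans (cong suc (∣p∪q∣+∣p∩q∣≡∣p∣+∣q∣ p q)) (sym (+-suc ∣ p ∣ ∣ q ∣))))

∣p∪q∣≤∣p∣+∣q∣ : ∀ (p q : Subset N) → ∣ p ∪ q ∣ ≤ ∣ p ∣ + ∣ q ∣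
∣p∪q∣≤∣p∣+∣q∣ p q = ≤-trans (m≤m+n _ _) (≤-reflexive (∣p∪q∣+∣p∩q∣≡∣p∣+∣q∣ p q))

Disjoint⇒∣p∣+∣q∣≤∣p∪q∣ : ∀ (p q : Subset N) → Disjoint p q → ∣ p ∣ + ∣ q ∣ ≤ ∣ p ∪ q ∣
Disjoint⇒∣p∣+∣q∣≤∣p∪q∣ {N} p q p∥q = ≤-reflexive (trans (sym (∣p∪q∣+∣p∩q∣≡∣p∣+∣q∣ p q))
  (trans (cong (λ s → ∣ p ∪ q ∣ + ∣ s ∣) p∩q≡⊥) (trans (cong (∣ p ∪ q ∣ +_) (∣⊥∣≡0 N)) (+-identityʳ _))))
  where
  p∩q≡⊥ : p ∩ q ≡ ⊥
  p∩q≡⊥ = Empty-unique λ (x , x∈) → let x∈p , x∈q = x∈p∩q⁻ p q x∈ in p∥q x∈p x∈q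

∣p∣≤∣p─q∣+∣q∣ : ∀ (p q : Subset N) → ∣ p ∣ ≤ ∣ p ─ q ∣ + ∣ q ∣
∣p∣≤∣p─q∣+∣q∣ p q = ≤-trans (p⊆q⇒∣p∣≤∣q∣ split) (∣p∪q∣≤∣p∣+∣q∣ (p ─ q) q)
  where
  split : p ⊆ (p ─ q) ∪ q
  split {x} x∈p with x ∈? q
  ... | yes x∈q = x∈p∪q⁺ (inj₂ x∈q)
  ... | no  x∉q = x∈p∪q⁺ (inj₁ (x∈p∧x∉q⇒x∈p─q x∈p x∉q))

p⊆q⇒∣q─p∣+∣p∣≤∣q∣ : ∀ {p q : Subset N} → p ⊆ q → ∣ q ─ p ∣ + ∣ p ∣ ≤ ∣ q ∣
p⊆q⇒∣q─p∣+∣p∣≤∣q∣ {p = p} {q} p⊆q = ≤-trans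
  (Disjoint⇒∣p∣+∣q∣≤∣p∪q∣ (q ─ p) p (x∈p─q⇒x∉q q p))
  (p⊆q⇒∣p∣≤∣q∣ (∪-lub (q ─ p) p (p─q⊆p q p) p⊆q))

p⊆q∧q⊈p⇒∣p∣<∣q∣ : ∀ {p q : Subset N} → p ⊆ q → ¬ q ⊆ p → ∣ p ∣ < ∣ q ∣
p⊆q∧q⊈p⇒∣p∣<∣q∣ {p = p} {q} p⊆q q⊈p with nonempty? (q ─ p)
... | yes (x , x∈) = p⊂q⇒∣p∣<∣q∣ (p⊆q , x , p─q⊆p q p x∈ , x∈p─q⇒x∉q q p x∈)
... | no empty = contradiction
  (λ {x} x∈q → decidable-stable (x ∈? p) λ x∉p → empty (x , x∈p∧x∉q⇒x∈p─q x∈q x∉p)) q⊈p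

-- The elements of p together with the first i elements of q ─ p.
grow : Subset N → Subset N → ℕ → Subset N
grow []            []            i       = []
grow (inside  ∷ p) (_       ∷ q) i       = inside  ∷ grow p q i
grow (outside ∷ p) (outside ∷ q) i       = outside ∷ grow p q i
grow (outside ∷ p) (inside  ∷ q) zero    = outside ∷ grow p q zero
grow (outside ∷ p) (inside  ∷ q) (suc i) = inside  ∷ grow p q i

grow-zero : ∀ (p q : Subset N) → grow p q 0 ≡ p
grow-zero []            []            = refl
grow-zero (inside  ∷ p) (_       ∷ q) = cong (inside ∷_) (grow-zero p q)
grow-zero (outside ∷ p) (outside ∷ q) = cong (outside ∷_) (grow-zero p q)
grow-zero (outside ∷ p) (inside  ∷ q) = cong (outside ∷_) (grow-zero p q)

p⊆grow : ∀ (p q : Subset N) i → p ⊆ grow p q i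
p⊆grow (inside  ∷ p) (_       ∷ q) i       here       = here
p⊆grow (inside  ∷ p) (_       ∷ q) i       (there x∈) = there (p⊆grow p q i x∈)
p⊆grow (outside ∷ p) (outside ∷ q) i       (there x∈) = there (p⊆grow p q i x∈)
p⊆grow (outside ∷ p) (inside  ∷ q) zero    (there x∈) = there (p⊆grow p q zero x∈)
p⊆grow (outside ∷ p) (inside  ∷ q) (suc i) (there x∈) = there (p⊆grow p q i x∈)

grow⊆q : ∀ (p q : Subset N) i → p ⊆ q → grow p q i ⊆ q
grow⊆q (inside  ∷ p) (_       ∷ q) i       p⊆q here       = p⊆q here
grow⊆q (inside  ∷ p) (_       ∷ q) i       p⊆q (there x∈) = there (grow⊆q p q i (drop-∷-⊆ p⊆q) x∈)
grow⊆q (outside ∷ p) (outside ∷ q) i       p⊆q (there x∈) = there (grow⊆q p q i (drop-∷-⊆ p⊆q) x∈)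
grow⊆q (outside ∷ p) (inside  ∷ q) zero    p⊆q (there x∈) = there (grow⊆q p q zero (drop-∷-⊆ p⊆q) x∈)
grow⊆q (outside ∷ p) (inside  ∷ q) (suc i) p⊆q here       = here
grow⊆q (outside ∷ p) (inside  ∷ q) (suc i) p⊆q (there x∈) = there (grow⊆q p q i (drop-∷-⊆ p⊆q) x∈)

grow-mono : ∀ (p q : Subset N) {i j} → i ≤ j → grow p q i ⊆ grow p q j
grow-mono []            []            i≤j       ()
grow-mono (inside  ∷ p) (_       ∷ q) i≤j       here       = here
grow-mono (inside  ∷ p) (_       ∷ q) i≤j       (there x∈) = there (grow-mono p q i≤j x∈)
grow-mono (outside ∷ p) (outside ∷ q) i≤j       (there x∈) = there (grow-mono p q i≤j x∈)
grow-mono (outside ∷ p) (inside  ∷ q) {j = zero}  z≤n       (there x∈) = there x∈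
grow-mono (outside ∷ p) (inside  ∷ q) {j = suc j} z≤n       (there x∈) = there (grow-mono p q z≤n x∈)
grow-mono (outside ∷ p) (inside  ∷ q) (s≤s i≤j) here       = here
grow-mono (outside ∷ p) (inside  ∷ q) (s≤s i≤j) (there x∈) = there (grow-mono p q i≤j x∈)

∣grow∣≤ : ∀ (p q : Subset N) i → ∣ grow p q i ∣ ≤ ∣ p ∣ + i
∣grow∣≤ []            []            i       = z≤n
∣grow∣≤ (inside  ∷ p) (_       ∷ q) i       = s≤s (∣grow∣≤ p q i)
∣grow∣≤ (outside ∷ p) (outside ∷ q) i       = ∣grow∣≤ p q i
∣grow∣≤ (outside ∷ p) (inside  ∷ q) zero    = ∣grow∣≤ p q zero
∣grow∣≤ (outside ∷ p) (inside  ∷ q) (suc i) = ≤-trans (s≤s (∣grow∣≤ p q i)) (≤-reflexive (sym (+-suc _ i)))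

-- Serves to show that the blocks cut from `q` stabilise and that an incomplete block is the last
-- one.
grow-full : ∀ (p q : Subset N) i → q ⊆ grow p q i ⊎ ∣ p ∣ + i ≤ ∣ grow p q i ∣
grow-full []            []            i = inj₁ id
grow-full (inside  ∷ p) (_       ∷ q) i with grow-full p q i
... | inj₁ q⊆ = inj₁ λ { here → here ; (there x∈) → there (q⊆ x∈) }
... | inj₂ le = inj₂ (s≤s le)
grow-full (outside ∷ p) (outside ∷ q) i with grow-full p q i
... | inj₁ q⊆ = inj₁ (s⊆s q⊆)
... | inj₂ le = inj₂ le
grow-full (outside ∷ p) (inside  ∷ q) zero =
  inj₂ (≤-reflexive (trans (+-identityʳ _) (cong ∣_∣ (sym (grow-zero p q)))))
grow-full (outside ∷ p) (inside  ∷ q) (suc i) with grow-full p q i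
... | inj₁ q⊆ = inj₁ (s⊆s q⊆)
... | inj₂ le = inj₂ (≤-trans (≤-reflexive (+-suc _ i)) (s≤s le))

subsetOfSize : ∀ (q : Subset N) {k} → k ≤ ∣ q ∣ → ∃[ p ] p ⊆ q × ∣ p ∣ ≡ k
subsetOfSize {N} q {k} k≤∣q∣ = grow ⊥ q k , grow⊆q ⊥ q k ⊥⊆ , ≤-antisym upper lower
  where
  upper : ∣ grow ⊥ q k ∣ ≤ k
  upper = ≤-trans (∣grow∣≤ ⊥ q k) (≤-reflexive (cong (_+ k) (∣⊥∣≡0 N)))
  lower : k ≤ ∣ grow ⊥ q k ∣
  lower with grow-full ⊥ q k
  ... | inj₁ q⊆ = ≤-trans k≤∣q∣ (p⊆q⇒∣p∣≤∣q∣ q⊆)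
  ... | inj₂ le = ≤-trans (m≤n+m k _) le

-- Identifies the subsets of Fin n with subsets of the first n elements of X.
embed : Subset N → Subset n → Subset N
embed []            _       = []
embed (outside ∷ X) v       = outside ∷ embed X v
embed (inside  ∷ X) []      = ⊥
embed (inside  ∷ X) (b ∷ v) = b ∷ embed X v

embed⊆ : ∀ (X : Subset N) (v : Subset n) → embed X v ⊆ X
embed⊆ (outside ∷ X) v       (there x∈) = there (embed⊆ X v x∈)
embed⊆ (inside  ∷ X) []      x∈         = contradiction x∈ ∉⊥
embed⊆ (inside  ∷ X) (b ∷ v) here       = here
embed⊆ (inside  ∷ X) (b ∷ v) (there x∈) = there (embed⊆ X v x∈)

embed-mono : ∀ (X : Subset N) (v w : Subset n) → v ⊆ w → embed X v ⊆ embed X w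
embed-mono (outside ∷ X) v       w       v⊆w (there x∈) = there (embed-mono X v w v⊆w x∈)
embed-mono (inside  ∷ X) []      []      v⊆w x∈         = x∈
embed-mono (inside  ∷ X) (b ∷ v) (_ ∷ w) v⊆w here with here ← v⊆w here = here
embed-mono (inside  ∷ X) (b ∷ v) (_ ∷ w) v⊆w (there x∈) = there (embed-mono X v w (drop-∷-⊆ v⊆w) x∈)

embed-reflects : ∀ (X : Subset N) (v w : Subset n) → n ≤ ∣ X ∣ → embed X v ⊆ embed X w → v ⊆ w
embed-reflects []            []      []       _        _   ()
embed-reflects (outside ∷ X) v       w        n≤       sub x∈ = embed-reflects X v w n≤ (drop-∷-⊆ sub) x∈
embed-reflects (inside  ∷ X) (b ∷ v) (b′ ∷ w) (s≤s n≤) sub here with here ← sub here = here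
embed-reflects (inside  ∷ X) (b ∷ v) (b′ ∷ w) (s≤s n≤) sub (there x∈) =
  there (embed-reflects X v w n≤ (drop-∷-⊆ sub) x∈)

-- Copies of Boolean lattices

-- The hypotheses force `F Z ∩ X = Z` for `Z ⊆ X`, so `Z` can be read off `F Z` and inclusions are
-- reflected.
copy : ∀ (c : Coloring N) b (X : Subset N) → n ≤ ∣ X ∣ → (F : Subset N → Subset N) →
  (∀ {Z} → Z ⊆ X → Z ⊆ F Z) →
  (∀ {Z x} → Z ⊆ X → x ∈ X → x ∈ F Z → x ∈ Z) →
  (∀ {Z Z′} → Z ⊆ Z′ → Z′ ⊆ X → F Z ⊆ F Z′) →
  (∀ {Z} → Z ⊆ X → c (F Z) ≡ b) → MonoCopy c b n
copy c b X n≤ F above trace mono colour = F ∘ embed X , isCopy , λ v → colour (embed⊆ X v)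
  where
  isCopy : IsCopy (F ∘ embed X)
  isCopy v w = (λ v⊆w → mono (embed-mono X v w v⊆w) (embed⊆ X w))
             , (λ Fv⊆Fw → embed-reflects X v w n≤ λ x∈ →
                  trace (embed⊆ X w) (embed⊆ X v x∈) (Fv⊆Fw (above (embed⊆ X v) x∈)))

copyAbove : ∀ (c : Coloring N) b (D X : Subset N) → Disjoint X D → n ≤ ∣ X ∣ →
  (∀ {Z} → Z ⊆ X → c (D ∪ Z) ≡ b) → MonoCopy c b n
copyAbove c b D X X∥D n≤ colour = copy c b X n≤ (D ∪_)
  (λ {Z} _ → q⊆p∪q D Z)
  (λ {Z} _ x∈X x∈ → [ (λ x∈D → contradiction x∈D (X∥D x∈X)) , id ]′ (x∈p∪q⁻ D Z x∈))
  (λ {Z} {Z′} Z⊆Z′ _ → ∪-lub D Z (p⊆p∪q Z′) (q⊆p∪q D Z′ ∘ Z⊆Z′))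
  colour

-- Otherwise the sets `D ∪ Z` would form a blue `Qₙ`. This supplies atoms, and through `dual`
-- coatoms, that avoid prescribed elements.
findRed : ∀ (c : Coloring N) → ¬ MonoCopy c false n → (D X : Subset N) → Disjoint X D → n ≤ ∣ X ∣ →
  ∃[ Z ] Z ⊆ X × c (D ∪ Z) ≡ true
findRed c noBlue D X X∥D n≤ with anySubset? (λ Z → (Z ⊆? X) ×-dec (c (D ∪ Z) ≟ᵇ true))
... | yes found = found
... | no  none  = contradiction
  (copyAbove c false D X X∥D n≤ λ {Z} Z⊆X → ¬-not λ red → none (Z , Z⊆X , red)) noBlue

-- The obstruction to a blue embedding

Gap : Coloring N → Subset N → (ℕ → Subset N) → Set
Gap c X C = ∃[ j ] ∃[ A ] ∃[ Z ] A ⊆ Z × Z ⊆ X × ∣ A ∣ + j ≤ ∣ Z ∣ × c (A ∪ C 0) ≡ true ×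
  -- All candidates for the extension of this `Z` are red: this is how the embedding fails.
  (∀ S → C j ⊆ S → S ⊆ C (suc j) → c (Z ∪ S) ≡ true)

-- Under the map Z ↦ Z ∪ S Z constructed here, a set Z of rank r receives C (pred r) ⊆ S Z ⊆ C r.
-- Only comparable sets of equal rank could break monotonicity; they exist for the extreme ranks alone,
-- where S is constant.
gap : ∀ (c : Coloring N) → ¬ MonoCopy c false n → (X : Subset N) → n ≤ ∣ X ∣ →
  (C : ℕ → Subset N) → (∀ {i j} → i ≤ j → C i ⊆ C j) → (∀ i → Disjoint X (C i)) →
  ∀ d → C (suc d) ⊆ C d →
  Gap c X C
gap {N} {n} c noBlue X n≤∣X∣ C C-mono X∥C d C-stable = conclusion
  where
  Reach : Subset N → ℕ → Set
  Reach Z j = ∃[ A ] A ⊆ Z × ∣ A ∣ + j ≤ ∣ Z ∣ × c (A ∪ C 0) ≡ true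

  reach? : ∀ Z j → Dec (Reach Z j)
  reach? Z j = anySubset? λ A → (A ⊆? Z) ×-dec (∣ A ∣ + j ≤? ∣ Z ∣) ×-dec (c (A ∪ C 0) ≟ᵇ true)

  rankUpTo : ℕ → Subset N → ℕ
  rankUpTo zero    Z = 0
  rankUpTo (suc j) Z with reach? Z j
  ... | yes _ = suc j
  ... | no  _ = rankUpTo j Z

  rankUpTo≤ : ∀ j Z → rankUpTo j Z ≤ j
  rankUpTo≤ zero    Z = z≤n
  rankUpTo≤ (suc j) Z with reach? Z j
  ... | yes _ = ≤-refl
  ... | no  _ = m≤n⇒m≤1+n (rankUpTo≤ j Z)

  reach-rankUpTo : ∀ j Z {i} → rankUpTo j Z ≡ suc i → Reach Z i
  reach-rankUpTo (suc j) Z eq with reach? Z j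
  reach-rankUpTo (suc j) Z refl | yes reach = reach
  ... | no  _ = reach-rankUpTo j Z eq

  rankUpTo-max : ∀ j Z {i} → i < j → Reach Z i → i < rankUpTo j Z
  rankUpTo-max (suc j) Z {i} (s≤s i≤j) reach with reach? Z j
  ... | yes _ = s≤s i≤j
  ... | no ¬reach with m≤n⇒m<n∨m≡n i≤j
  ...   | inj₁ i<j  = rankUpTo-max j Z i<j reach
  ...   | inj₂ refl = contradiction reach ¬reach

  -- Rank zero is left for the sets with no red `A ∪ C 0` below them. The cap makes the rank a
  -- finite search; at the cap the block is empty by `C-stable`.
  rank : Subset N → ℕ
  rank = rankUpTo (suc d)

  rank-mono : ∀ {Z Z′} → Z ⊆ Z′ → rank Z ≤ rank Z′
  rank-mono {Z} {Z′} Z⊆Z′ with rank Z in eq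
  ... | zero  = z≤n
  ... | suc j with reach-rankUpTo (suc d) Z eq
  ...   | A , A⊆Z , le , red = rankUpTo-max (suc d) Z′
    (≤-trans (≤-reflexive (sym eq)) (rankUpTo≤ (suc d) Z))
    (A , Z⊆Z′ ∘ A⊆Z , ≤-trans le (p⊆q⇒∣p∣≤∣q∣ Z⊆Z′) , red)

  Blue : Subset N → Subset N → Set
  Blue Z S = C (pred (rank Z)) ⊆ S × S ⊆ C (rank Z) × c (Z ∪ S) ≡ false

  blue? : ∀ Z → Dec (∃ (Blue Z))
  blue? Z = anySubset? λ S → (_ ⊆? S) ×-dec (S ⊆? _) ×-dec (c (Z ∪ S) ≟ᵇ false)

  extension : Subset N → Subset N
  extension Z with blue? Z
  ... | yes (S , _) = S
  -- Never reached in the copy below, where every `Z ⊆ X` has a blue extension.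
  ... | no  _       = ⊥

  extension-blue : ∀ Z → ∃ (Blue Z) → Blue Z (extension Z)
  extension-blue Z ex with blue? Z
  ... | yes (_ , blue) = blue
  ... | no  none       = contradiction ex none

  extension-mono : ∀ {Z Z′} → ∃ (Blue Z) → ∃ (Blue Z′) → Z ⊆ Z′ → extension Z ⊆ Z′ ∪ extension Z′
  extension-mono {Z} {Z′} ex ex′ Z⊆Z′ x∈
    with extension-blue Z ex | extension-blue Z′ ex′ | m≤n⇒m<n∨m≡n (rank-mono Z⊆Z′)
  ... | _ , S⊆C , _ | C⊆S′ , _ | inj₁ r<r′ =
    q⊆p∪q Z′ (extension Z′) (C⊆S′ (C-mono (pred-mono-≤ r<r′) (S⊆C x∈)))
  ... | _ , S⊆C , _ | C⊆S′ , _ | inj₂ r≡r′ with Z′ ⊆? Z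
  ...   | yes Z′⊆Z with refl ← ⊆-antisym Z⊆Z′ Z′⊆Z = q⊆p∪q Z′ (extension Z′) x∈
  ...   | no  Z′⊈Z = q⊆p∪q Z′ (extension Z′) (C⊆S′ (constant (rank Z) refl (S⊆C x∈)))
    where
    constant : ∀ r → rank Z ≡ r → C (rank Z) ⊆ C (pred (rank Z′))
    constant zero    eq y∈ = C-mono (≤-trans (≤-reflexive eq) z≤n) y∈
    -- The same `A` lies at least one step deeper below a strictly larger `Z′`, so equal positive
    -- ranks occur only at the cap.
    constant (suc j) eq with reach-rankUpTo (suc d) Z eq | j <? d
    ... | A , A⊆Z , le , red | yes j<d = contradiction
      (≤-trans (rankUpTo-max (suc d) Z′ (s≤s j<d)
         (A , Z⊆Z′ ∘ A⊆Z , ≤-trans (≤-reflexive (+-suc ∣ A ∣ j))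
           (≤-trans (s≤s le) (p⊆q∧q⊈p⇒∣p∣<∣q∣ Z⊆Z′ Z′⊈Z)) , red))
         (≤-reflexive (trans (sym r≡r′) eq)))
      1+n≰n
    ... | _ | no j≮d = λ y∈ → C-mono (≤-trans (≮⇒≥ j≮d) (≤-reflexive (cong pred (trans (sym eq) r≡r′))))
      (C-stable (C-mono (rankUpTo≤ (suc d) Z) y∈))

  conclusion : Gap c X C
  conclusion with anySubset? (λ Z → (Z ⊆? X) ×-dec ¬? (blue? Z))
  ... | no none = contradiction
    (copy c false X n≤∣X∣ (λ Z → Z ∪ extension Z)
      (λ {Z} _ → p⊆p∪q (extension Z))
      (λ {Z} Z⊆X x∈X x∈ → [ id , (λ x∈S → contradiction
        (proj₁ (proj₂ (extension-blue Z (exists Z⊆X))) x∈S) (X∥C _ x∈X)) ]′ (x∈p∪q⁻ Z (extension Z) x∈))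
      (λ {Z} {Z′} Z⊆Z′ Z′⊆X → ∪-lub Z (extension Z) (p⊆p∪q (extension Z′) ∘ Z⊆Z′)
        (extension-mono (exists (Z′⊆X ∘ Z⊆Z′)) (exists Z′⊆X) Z⊆Z′))
      (λ {Z} Z⊆X → proj₂ (proj₂ (extension-blue Z (exists Z⊆X)))))
    noBlue
    where
    exists : ∀ {Z} → Z ⊆ X → ∃ (Blue Z)
    exists {Z} Z⊆X = decidable-stable (blue? Z) λ none′ → none (Z , Z⊆X , none′)
  ... | yes (Z , Z⊆X , noneZ) with rank Z in eq
  -- At rank zero `C 0` is the only candidate. If it is not blue, `Z` itself serves as the red `A`,
  -- and the rank is positive.
  ...   | zero = contradiction
    (≤-trans (rankUpTo-max (suc d) Z (s≤s z≤n)
      (Z , id , ≤-reflexive (+-identityʳ _) , ¬-not λ blue → noneZ (C 0 , id , id , blue)))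
      (≤-reflexive eq))
    1+n≰n
  ...   | suc j with reach-rankUpTo (suc d) Z eq
  ...     | A , A⊆Z , le , red = j , A , Z , A⊆Z , Z⊆X , le , red ,
    λ S C⊆S S⊆C → ¬-not λ blue → noneZ (S , C⊆S , S⊆C , blue)

-- E consists of the elements of Q ─ P left over by the triples.
TripleGap : Coloring N → (X P Q : Subset N) → Set
TripleGap c X P Q = ∃[ j ] ∃[ A ] ∃[ Z ] ∃[ E ] A ⊆ Z × Z ⊆ X × ∣ A ∣ + j ≤ ∣ Z ∣ × c (A ∪ P) ≡ true ×
  E ⊆ Q × ∣ E ∣ ≤ 2 × ∣ Q ∣ ≤ ∣ P ∣ + (3 * j + ∣ E ∣) × (∀ {S} → S ⊆ E → c (Z ∪ (Q ─ S)) ≡ true)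

-- The red block delivered by `gap` cannot have three elements, since its subsets would form a red
-- `Q₃`. Being incomplete, it exhausts `Q`, so that `j` triples and `E` cover `Q ─ P`.
gapOfTriples : ∀ (c : Coloring N) → ¬ MonoCopy c true 3 → ¬ MonoCopy c false n →
  (P Q X : Subset N) → P ⊆ Q → Disjoint X Q → n ≤ ∣ X ∣ →
  TripleGap c X P Q
gapOfTriples {N} c noRed noBlue P Q X P⊆Q X∥Q n≤∣X∣ =
  conclude (gap c noBlue X n≤∣X∣ C (grow-mono P Q ∘ *-monoʳ-≤ 3) (λ i x∈X → X∥Q x∈X ∘ C⊆Q i) (suc ∣ Q ∣) stable)
  where
  C : ℕ → Subset N
  C i = grow P Q (3 * i)

  C⊆Q : ∀ i → C i ⊆ Q
  C⊆Q i = grow⊆q P Q (3 * i) P⊆Q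

  -- `Q` has no room for `3 * suc ∣ Q ∣` new elements, so it is used up at this index.
  stable : C (suc (suc ∣ Q ∣)) ⊆ C (suc ∣ Q ∣)
  stable with grow-full P Q (3 * suc ∣ Q ∣)
  ... | inj₁ Q⊆ = Q⊆ ∘ C⊆Q (suc (suc ∣ Q ∣))
  ... | inj₂ le = contradiction
    (≤-trans (≤-trans (m≤m+n (suc ∣ Q ∣) _) (m≤n+m _ ∣ P ∣)) (≤-trans le (p⊆q⇒∣p∣≤∣q∣ (C⊆Q (suc ∣ Q ∣)))))
    1+n≰n

  conclude : Gap c X C → TripleGap c X P Q
  conclude (j , A , Z , A⊆Z , Z⊆X , le , redA , redBlock) =
    j , A , Z , E , A⊆Z , Z⊆X , le , subst (λ D → c (A ∪ D) ≡ true) (grow-zero P Q) redA ,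
    E⊆Q , ∣E∣≤2 , ∣Q∣≤ , redTop
    where
    E : Subset N
    E = C (suc j) ─ C j

    C⊆C : C j ⊆ C (suc j)
    C⊆C = grow-mono P Q (*-monoʳ-≤ 3 (n≤1+n j))

    E⊆C : E ⊆ C (suc j)
    E⊆C = p─q⊆p (C (suc j)) (C j)

    E∥C : Disjoint E (C j)
    E∥C = x∈p─q⇒x∉q (C (suc j)) (C j)

    E⊆Q : E ⊆ Q
    E⊆Q = C⊆Q (suc j) ∘ E⊆C

    ∣E∣≤2 : ∣ E ∣ ≤ 2
    ∣E∣≤2 = ≮⇒≥ λ 3≤∣E∣ → noRed (copyAbove c true (Z ∪ C j) E
      (∪-disjoint Z (C j) (λ x∈E x∈Z → X∥Q (Z⊆X x∈Z) (E⊆Q x∈E)) E∥C) 3≤∣E∣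
      (λ {S} S⊆E → subst (λ D → c D ≡ true) (sym (∪-assoc Z (C j) S))
        (redBlock (C j ∪ S) (p⊆p∪q S) (∪-lub (C j) S C⊆C (E⊆C ∘ S⊆E)))))

    ∣C∣≤ : ∣ C (suc j) ∣ ≤ ∣ P ∣ + (3 * j + ∣ E ∣)
    ∣C∣≤ = begin
      ∣ C (suc j) ∣             ≤⟨ ∣p∣≤∣p─q∣+∣q∣ (C (suc j)) (C j) ⟩
      ∣ E ∣ + ∣ C j ∣           ≤⟨ +-monoʳ-≤ ∣ E ∣ (∣grow∣≤ P Q (3 * j)) ⟩
      ∣ E ∣ + (∣ P ∣ + 3 * j)   ≡⟨ +-comm ∣ E ∣ _ ⟩
      ∣ P ∣ + 3 * j + ∣ E ∣     ≡⟨ +-assoc ∣ P ∣ _ _ ⟩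
      ∣ P ∣ + (3 * j + ∣ E ∣)   ∎
      where open ≤-Reasoning

    Q⊆C : Q ⊆ C (suc j)
    Q⊆C with grow-full P Q (3 * suc j)
    ... | inj₁ Q⊆ = Q⊆
    ... | inj₂ le = contradiction (+-cancelˡ-≤ (3 * j) 3 ∣ E ∣ (+-cancelˡ-≤ ∣ P ∣ _ _
      (≤-trans (≤-reflexive (cong (∣ P ∣ +_) (trans (+-comm (3 * j) 3) (sym (*-suc 3 j))))) (≤-trans le ∣C∣≤))))
      (<⇒≱ (s≤s ∣E∣≤2))

    ∣Q∣≤ : ∣ Q ∣ ≤ ∣ P ∣ + (3 * j + ∣ E ∣)
    ∣Q∣≤ = ≤-trans (p⊆q⇒∣p∣≤∣q∣ Q⊆C) ∣C∣≤

    redTop : ∀ {S} → S ⊆ E → c (Z ∪ (Q ─ S)) ≡ true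
    redTop {S} S⊆E = redBlock (Q ─ S)
      (λ x∈C → x∈p∧x∉q⇒x∈p─q (C⊆Q j x∈C) λ x∈S → E∥C (S⊆E x∈S) x∈C)
      (Q⊆C ∘ p─q⊆p Q S)

-- Red cubes from atoms and coatoms

pattern #0 = zero
pattern #1 = suc zero
pattern #2 = suc (suc zero)

-- `C i` is the coatom opposite to the atom `P i`, and `y i` witnesses that it does not contain this
-- atom. This alone gives reflection of the order: for `i` in `v` but not in `w`, `y i` lies in
-- `f v`, while `f w` is contained in `C i`.
redCube : ∀ (c : Coloring N) (A T : Subset N) (P C : Fin 3 → Subset N) (y : Fin 3 → Fin N) →
  (∀ i → A ⊆ P i) → (∀ {i j} → i ≢ j → P i ⊆ C j) → (∀ i → C i ⊆ T) → (∀ i → y i ∈ P i) → (∀ i → y i ∉ C i) →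
  c A ≡ true → (∀ i → c (P i) ≡ true) → (∀ i → c (C i) ≡ true) → c T ≡ true → MonoCopy c true 3
redCube {N} c A T P C y A⊆P P⊆C C⊆T y∈P y∉C redA redP redC redT =
  f , (λ v w → mono v w , reflects v w) , red
  where
  f : Subset 3 → Subset N
  f (outside ∷ outside ∷ outside ∷ []) = A
  f (inside  ∷ outside ∷ outside ∷ []) = P #0
  f (outside ∷ inside  ∷ outside ∷ []) = P #1
  f (outside ∷ outside ∷ inside  ∷ []) = P #2
  f (outside ∷ inside  ∷ inside  ∷ []) = C #0
  f (inside  ∷ outside ∷ inside  ∷ []) = C #1
  f (inside  ∷ inside  ∷ outside ∷ []) = C #2
  f (inside  ∷ inside  ∷ inside  ∷ []) = T

  red : ∀ v → c (f v) ≡ true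
  red (outside ∷ outside ∷ outside ∷ []) = redA
  red (inside  ∷ outside ∷ outside ∷ []) = redP #0
  red (outside ∷ inside  ∷ outside ∷ []) = redP #1
  red (outside ∷ outside ∷ inside  ∷ []) = redP #2
  red (outside ∷ inside  ∷ inside  ∷ []) = redC #0
  red (inside  ∷ outside ∷ inside  ∷ []) = redC #1
  red (inside  ∷ inside  ∷ outside ∷ []) = redC #2
  red (inside  ∷ inside  ∷ inside  ∷ []) = redT

  P⊆T : ∀ i → P i ⊆ T
  P⊆T #0 = C⊆T #1 ∘ P⊆C λ ()
  P⊆T #1 = C⊆T #0 ∘ P⊆C λ ()
  P⊆T #2 = C⊆T #0 ∘ P⊆C λ ()

  P⊆f : ∀ v {i} → i ∈ v → P i ⊆ f v
  P⊆f (inside  ∷ outside ∷ outside ∷ []) here                  = id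
  P⊆f (outside ∷ inside  ∷ outside ∷ []) (there here)          = id
  P⊆f (outside ∷ outside ∷ inside  ∷ []) (there (there here))  = id
  P⊆f (outside ∷ inside  ∷ inside  ∷ []) (there here)          = P⊆C λ ()
  P⊆f (outside ∷ inside  ∷ inside  ∷ []) (there (there here))  = P⊆C λ ()
  P⊆f (inside  ∷ outside ∷ inside  ∷ []) here                  = P⊆C λ ()
  P⊆f (inside  ∷ outside ∷ inside  ∷ []) (there (there here))  = P⊆C λ ()
  P⊆f (inside  ∷ inside  ∷ outside ∷ []) here                  = P⊆C λ ()
  P⊆f (inside  ∷ inside  ∷ outside ∷ []) (there here)          = P⊆C λ ()
  P⊆f (inside  ∷ inside  ∷ inside  ∷ []) {i} _                 = P⊆T i
  P⊆f (inside  ∷ outside ∷ outside ∷ []) (there (there (there ())))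
  P⊆f (outside ∷ inside  ∷ outside ∷ []) (there (there (there ())))
  P⊆f (inside  ∷ inside  ∷ outside ∷ []) (there (there (there ())))

  f⊆C : ∀ v {i} → i ∉ v → f v ⊆ C i
  f⊆C (outside ∷ outside ∷ outside ∷ []) {#0} _ = P⊆C {#1} (λ ()) ∘ A⊆P #1
  f⊆C (outside ∷ outside ∷ outside ∷ []) {#1} _ = P⊆C {#0} (λ ()) ∘ A⊆P #0
  f⊆C (outside ∷ outside ∷ outside ∷ []) {#2} _ = P⊆C {#0} (λ ()) ∘ A⊆P #0
  f⊆C (inside  ∷ outside ∷ outside ∷ []) {#1} _ = P⊆C λ ()
  f⊆C (inside  ∷ outside ∷ outside ∷ []) {#2} _ = P⊆C λ ()
  f⊆C (outside ∷ inside  ∷ outside ∷ []) {#0} _ = P⊆C λ ()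
  f⊆C (outside ∷ inside  ∷ outside ∷ []) {#2} _ = P⊆C λ ()
  f⊆C (outside ∷ outside ∷ inside  ∷ []) {#0} _ = P⊆C λ ()
  f⊆C (outside ∷ outside ∷ inside  ∷ []) {#1} _ = P⊆C λ ()
  f⊆C (outside ∷ inside  ∷ inside  ∷ []) {#0} _ = id
  f⊆C (inside  ∷ outside ∷ inside  ∷ []) {#1} _ = id
  f⊆C (inside  ∷ inside  ∷ outside ∷ []) {#2} _ = id
  f⊆C (inside  ∷ _       ∷ _       ∷ []) {#0} i∉ = contradiction here i∉
  f⊆C (_       ∷ inside  ∷ _       ∷ []) {#1} i∉ = contradiction (there here) i∉
  f⊆C (_       ∷ _       ∷ inside  ∷ []) {#2} i∉ = contradiction (there (there here)) i∉

  A⊆f : ∀ v → A ⊆ f v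
  A⊆f (outside ∷ outside ∷ outside ∷ []) = id
  A⊆f v@(inside ∷ _ ∷ _ ∷ [])            = P⊆f v here ∘ A⊆P #0
  A⊆f v@(_ ∷ inside ∷ _ ∷ [])            = P⊆f v (there here) ∘ A⊆P #1
  A⊆f v@(_ ∷ _ ∷ inside ∷ [])            = P⊆f v (there (there here)) ∘ A⊆P #2

  mono : ∀ v w → v ⊆ w → f v ⊆ f w
  mono (outside ∷ outside ∷ outside ∷ []) w v⊆w = A⊆f w
  mono (inside  ∷ outside ∷ outside ∷ []) w v⊆w = P⊆f w (v⊆w here)
  mono (outside ∷ inside  ∷ outside ∷ []) w v⊆w = P⊆f w (v⊆w (there here))
  mono (outside ∷ outside ∷ inside  ∷ []) w v⊆w = P⊆f w (v⊆w (there (there here)))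
  mono (outside ∷ inside  ∷ inside  ∷ []) (b ∷ _ ∷ _ ∷ []) v⊆w
    with there here ← v⊆w (there here) | there (there here) ← v⊆w (there (there here)) | b
  ... | outside = id
  ... | inside  = C⊆T #0
  mono (inside  ∷ outside ∷ inside  ∷ []) (_ ∷ b ∷ _ ∷ []) v⊆w
    with here ← v⊆w here | there (there here) ← v⊆w (there (there here)) | b
  ... | outside = id
  ... | inside  = C⊆T #1
  mono (inside  ∷ inside  ∷ outside ∷ []) (_ ∷ _ ∷ b ∷ []) v⊆w
    with here ← v⊆w here | there here ← v⊆w (there here) | b
  ... | outside = id
  ... | inside  = C⊆T #2
  mono (inside  ∷ inside  ∷ inside  ∷ []) (_ ∷ _ ∷ _ ∷ []) v⊆w
    with here ← v⊆w here | there here ← v⊆w (there here) | there (there here) ← v⊆w (there (there here)) = id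

  reflects : ∀ v w → f v ⊆ f w → v ⊆ w
  reflects v w fv⊆fw {i} i∈v = decidable-stable (i ∈? w) λ i∉w →
    y∉C i (f⊆C w i∉w (fv⊆fw (P⊆f v i∈v (y∈P i))))

-- Complementation

dual : Coloring N → Coloring N
dual c = c ∘ ∁

-- Complementing both the argument and the value reverses the order twice.
dualCopy : ∀ (c : Coloring N) b → MonoCopy (dual c) b k → MonoCopy c b k
dualCopy c b (f , isCopy , colour) = (λ v → ∁ (f (∁ v))) , isCopy′ , colour ∘ ∁
  where
  isCopy′ : IsCopy (λ v → ∁ (f (∁ v)))
  isCopy′ v w = (λ v⊆w → p⊆q⇒∁p⊇∁q (proj₁ (isCopy (∁ w) (∁ v)) (p⊆q⇒∁p⊇∁q v⊆w)))
              , (λ sub → ∁p⊆∁q⇒p⊇q (proj₂ (isCopy (∁ w) (∁ v)) (∁p⊆∁q⇒p⊇q sub)))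

Avoids : ℕ → Coloring N → Set
Avoids n c = ¬ MonoCopy c true 3 × ¬ MonoCopy c false n

avoids-dual : ∀ {c : Coloring N} → Avoids n c → Avoids n (dual c)
avoids-dual {c = c} (noRed , noBlue) = noRed ∘ dualCopy c true , noBlue ∘ dualCopy c false

-- The interval [A, ∁ V]; describing its top by V makes complementation exchange A and V.
record Interval (c : Coloring N) (A V : Subset N) : Set where
  field
    A∥V       : Disjoint A V
    redBottom : c A ≡ true
    redTop    : c (∁ V) ≡ true

interval-dual : ∀ {c : Coloring N} {A V} → Interval c A V → Interval (dual c) V A
interval-dual {c = c} {A} I = record
  { A∥V       = λ x∈V x∈A → A∥V x∈A x∈V
  ; redBottom = redTop
  ; redTop    = subst (λ D → c D ≡ true) (sym (∁-involutive A)) redBottom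
  }
  where open Interval I

∪-disjointˡ : ∀ (p q : Subset N) {r} → Disjoint p r → Disjoint q r → Disjoint (p ∪ q) r
∪-disjointˡ p q p∥r q∥r x∈ x∈r = ∪-disjoint p q (λ x∈r x∈p → p∥r x∈p x∈r) (λ x∈r x∈q → q∥r x∈q x∈r) x∈r x∈

⁅⁆⊆ : ∀ {p : Subset N} {y} → y ∈ p → ⁅ y ⁆ ⊆ p
⁅⁆⊆ {y = y} y∈p x∈ with refl ← x∈⁅y⁆⇒x≡y y x∈ = y∈p

⁅⁆-disjoint : ∀ {p : Subset N} {y} → y ∉ p → Disjoint ⁅ y ⁆ p
⁅⁆-disjoint {y = y} y∉p x∈ with refl ← x∈⁅y⁆⇒x≡y y x∈ = y∉p

disjoint-⁅⁆ : ∀ {p : Subset N} {y} → y ∉ p → Disjoint p ⁅ y ⁆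
disjoint-⁅⁆ y∉p x∈p x∈ = ⁅⁆-disjoint y∉p x∈ x∈p

other₁ other₂ : Fin 3 → Fin 3
other₁ #0 = #1
other₁ #1 = #0
other₁ #2 = #0
other₂ #0 = #2
other₂ #1 = #2
other₂ #2 = #1

others-distinct : ∀ i → other₁ i ≢ other₂ i
others-distinct #0 ()
others-distinct #1 ()
others-distinct #2 ()

others-exhaustive : ∀ {i j} → i ≢ j → i ≡ other₁ j ⊎ i ≡ other₂ j
others-exhaustive {#0} {#0} i≢j = contradiction refl i≢j
others-exhaustive {#0} {#1} i≢j = inj₁ refl
others-exhaustive {#0} {#2} i≢j = inj₁ refl
others-exhaustive {#1} {#0} i≢j = inj₁ refl
others-exhaustive {#1} {#1} i≢j = contradiction refl i≢j
others-exhaustive {#1} {#2} i≢j = inj₂ refl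
others-exhaustive {#2} {#0} i≢j = inj₂ refl
others-exhaustive {#2} {#1} i≢j = inj₂ refl
others-exhaustive {#2} {#2} i≢j = contradiction refl i≢j

-- The coatom missing y i only has to contain the other two atoms, so its complement may meet U i;
-- this is why pairwise unions are all that has to be small.
noThreeAtoms : ∀ {c : Coloring N} {A V} → Avoids n c → Interval c A V →
  (R : Subset N) → Disjoint R A → Disjoint R V → n + k ≤ ∣ R ∣ →
  (y : Fin 3 → Fin N) → (∀ i → y i ∈ R) → (∀ {i j} → i ≢ j → y i ≢ y j) →
  (U : Fin 3 → Subset N) → (∀ i → U i ⊆ R) → (∀ {i j} → i ≢ j → y i ∉ U j) →
  (∀ {i j} → i ≢ j → ∣ U i ∪ U j ∣ + 3 ≤ k) →
  ¬ (∀ i → c ((A ∪ ⁅ y i ⁆) ∪ U i) ≡ true)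
noThreeAtoms {N} {n} {k} {c} {A} {V} (noRed , noBlue) I R R∥A R∥V n+k≤∣R∣ y y∈R y-distinct U U⊆R y∉U small redAtom =
  noRed (redCube c A (∁ V) atom coatom y
    (λ i → p⊆p∪q (U i) ∘ p⊆p∪q ⁅ y i ⁆)
    (λ i≢j x∈ → x∉p⇒x∈∁p (atom∥coatom i≢j x∈))
    (λ i → p⊆q⇒∁p⊇∁q (p⊆p∪q (W i) ∘ p⊆p∪q ⁅ y i ⁆))
    (λ i → p⊆p∪q (U i) (q⊆p∪q A ⁅ y i ⁆ (x∈⁅x⁆ (y i))))
    (λ i y∈ → x∈∁p⇒x∉p y∈ (p⊆p∪q (W i) (q⊆p∪q V ⁅ y i ⁆ (x∈⁅x⁆ (y i)))))
    redBottom redAtom (λ i → proj₂ (proj₂ (found i))) redTop)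
  where
  open Interval I

  ys : Subset N
  ys = ⁅ y #0 ⁆ ∪ ⁅ y #1 ⁆ ∪ ⁅ y #2 ⁆

  ∣ys∣≤3 : ∣ ys ∣ ≤ 3
  ∣ys∣≤3 = begin
    ∣ ys ∣ ≤⟨ ∣p∪q∣≤∣p∣+∣q∣ ⁅ y #0 ⁆ _ ⟩
    ∣ ⁅ y #0 ⁆ ∣ + ∣ ⁅ y #1 ⁆ ∪ ⁅ y #2 ⁆ ∣ ≤⟨ +-monoʳ-≤ ∣ ⁅ y #0 ⁆ ∣ (∣p∪q∣≤∣p∣+∣q∣ ⁅ y #1 ⁆ _) ⟩
    ∣ ⁅ y #0 ⁆ ∣ + (∣ ⁅ y #1 ⁆ ∣ + ∣ ⁅ y #2 ⁆ ∣)
      ≡⟨ cong₂ _+_ (∣⁅x⁆∣≡1 (y #0)) (cong₂ _+_ (∣⁅x⁆∣≡1 (y #1)) (∣⁅x⁆∣≡1 (y #2))) ⟩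
    3 ∎
    where open ≤-Reasoning

  y∈ys : ∀ i → y i ∈ ys
  y∈ys #0 = p⊆p∪q _ (x∈⁅x⁆ (y #0))
  y∈ys #1 = q⊆p∪q ⁅ y #0 ⁆ _ (p⊆p∪q _ (x∈⁅x⁆ (y #1)))
  y∈ys #2 = q⊆p∪q ⁅ y #0 ⁆ _ (q⊆p∪q ⁅ y #1 ⁆ _ (x∈⁅x⁆ (y #2)))

  -- What the complement of coatom `i` has to avoid: the `U` of the two atoms below it and all three
  -- `y`, its own being added separately. The latter account for the 3 in `small`.
  B : Fin 3 → Subset N
  B i = (U (other₁ i) ∪ U (other₂ i)) ∪ ys

  U⊆B : ∀ {i j} → i ≢ j → U i ⊆ B j
  U⊆B {j = j} i≢j with others-exhaustive i≢j
  ... | inj₁ refl = p⊆p∪q ys ∘ p⊆p∪q (U (other₂ j))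
  ... | inj₂ refl = p⊆p∪q ys ∘ q⊆p∪q (U (other₁ j)) _

  y∈B : ∀ i j → y i ∈ B j
  y∈B i j = q⊆p∪q (U (other₁ j) ∪ U (other₂ j)) ys (y∈ys i)

  n≤∣R─B∣ : ∀ i → n ≤ ∣ R ─ B i ∣
  n≤∣R─B∣ i = +-cancelʳ-≤ k n _ (begin
    n + k                    ≤⟨ n+k≤∣R∣ ⟩
    ∣ R ∣                    ≤⟨ ∣p∣≤∣p─q∣+∣q∣ R (B i) ⟩
    ∣ R ─ B i ∣ + ∣ B i ∣    ≤⟨ +-monoʳ-≤ _ (≤-trans (∣p∪q∣≤∣p∣+∣q∣ (U (other₁ i) ∪ U (other₂ i)) ys)
                                 (≤-trans (+-monoʳ-≤ _ ∣ys∣≤3) (small (others-distinct i)))) ⟩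
    ∣ R ─ B i ∣ + k          ∎)
    where open ≤-Reasoning

  found : ∀ i → ∃[ W ] W ⊆ R ─ B i × dual c ((V ∪ ⁅ y i ⁆) ∪ W) ≡ true
  found i = findRed (dual c) (noBlue ∘ dualCopy c false) (V ∪ ⁅ y i ⁆) (R ─ B i)
    (∪-disjoint V ⁅ y i ⁆ (R∥V ∘ p─q⊆p R (B i))
      (disjoint-⁅⁆ λ y∈ → x∈p─q⇒x∉q R (B i) y∈ (y∈B i i)))
    (n≤∣R─B∣ i)

  W atom coatom : Fin 3 → Subset N
  W i      = proj₁ (found i)
  atom i   = (A ∪ ⁅ y i ⁆) ∪ U i
  coatom i = ∁ ((V ∪ ⁅ y i ⁆) ∪ W i)

  W⊆R : ∀ i → W i ⊆ R
  W⊆R i = p─q⊆p R (B i) ∘ proj₁ (proj₂ (found i))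

  B∥W : ∀ i → Disjoint (B i) (W i)
  B∥W i x∈B x∈W = x∈p─q⇒x∉q R (B i) (proj₁ (proj₂ (found i)) x∈W) x∈B

  atom∥coatom : ∀ {i j} → i ≢ j → Disjoint (atom i) ((V ∪ ⁅ y j ⁆) ∪ W j)
  atom∥coatom {i} {j} i≢j = ∪-disjointˡ (A ∪ ⁅ y i ⁆) (U i)
    (∪-disjointˡ A ⁅ y i ⁆
      (∪-disjoint _ (W j) (∪-disjoint V _ A∥V (disjoint-⁅⁆ (R∥A (y∈R j)))) (λ x∈A x∈W → R∥A (W⊆R j x∈W) x∈A))
      (⁅⁆-disjoint λ y∈ → [ (λ y∈ → [ R∥V (y∈R i) , y-distinct i≢j ∘ x∈⁅y⁆⇒x≡y (y j) ]′ (x∈p∪q⁻ V _ y∈))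
                          , B∥W j (y∈B i j) ]′ (x∈p∪q⁻ (V ∪ ⁅ y j ⁆) (W j) y∈)))
    (∪-disjoint _ (W j) (∪-disjoint V _ (R∥V ∘ U⊆R i) (disjoint-⁅⁆ (y∉U (i≢j ∘ sym)))) (B∥W j ∘ U⊆B i≢j))

-- Triangles

∈-removeʳ : ∀ {p : Subset N} {x y} → y ∈ p - x → y ∈ p × x ≢ y
∈-removeʳ {p = p} {x} y∈ = p─q⊆p p ⁅ x ⁆ y∈ , λ { refl → x∈p─q⇒x∉q p ⁅ x ⁆ y∈ (x∈⁅x⁆ x) }

∣p-x∣≥ : ∀ (p : Subset N) x {k} → suc k ≤ ∣ p ∣ → k ≤ ∣ p - x ∣
∣p-x∣≥ p x {k} le = +-cancelʳ-≤ 1 k _ (begin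
  k + 1                    ≡⟨ +-comm k 1 ⟩
  suc k                    ≤⟨ le ⟩
  ∣ p ∣                    ≤⟨ ∣p∣≤∣p─q∣+∣q∣ p ⁅ x ⁆ ⟩
  ∣ p - x ∣ + ∣ ⁅ x ⁆ ∣    ≡⟨ cong (∣ p - x ∣ +_) (∣⁅x⁆∣≡1 x) ⟩
  ∣ p - x ∣ + 1            ∎)
  where open ≤-Reasoning

nonempty : ∀ (p : Subset N) → 1 ≤ ∣ p ∣ → Nonempty p
nonempty {N} p 1≤∣p∣ with nonempty? p
... | yes x∈p = x∈p
... | no  empty with refl ← Empty-unique empty = contradiction (≤-trans 1≤∣p∣ (≤-reflexive (∣⊥∣≡0 N))) λ ()

triple : ∀ {A : Set} → A → A → A → Fin 3 → A
triple x y z #0 = x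
triple x y z #1 = y
triple x y z #2 = z

triple-pairwise : ∀ {A : Set} (E : A → A → Set) {x y z} → (∀ {a b} → E a b → E b a) →
  E x y → E x z → E y z → ∀ {i j} → i ≢ j → E (triple x y z i) (triple x y z j)
triple-pairwise _ E-sym xy xz yz {#0} {#0} i≢j = contradiction refl i≢j
triple-pairwise _ E-sym xy xz yz {#0} {#1} i≢j = xy
triple-pairwise _ E-sym xy xz yz {#0} {#2} i≢j = xz
triple-pairwise _ E-sym xy xz yz {#1} {#0} i≢j = E-sym xy
triple-pairwise _ E-sym xy xz yz {#1} {#1} i≢j = contradiction refl i≢j
triple-pairwise _ E-sym xy xz yz {#1} {#2} i≢j = yz
triple-pairwise _ E-sym xy xz yz {#2} {#0} i≢j = E-sym xz
triple-pairwise _ E-sym xy xz yz {#2} {#1} i≢j = E-sym yz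
triple-pairwise _ E-sym xy xz yz {#2} {#2} i≢j = contradiction refl i≢j

record Triangle (E : Fin N → Fin N → Set) (p : Subset N) : Set where
  constructor triangle
  field
    vertex   : Fin 3 → Fin N
    vertex∈  : ∀ i → vertex i ∈ p
    distinct : ∀ {i j} → i ≢ j → vertex i ≢ vertex j
    edge     : ∀ {i j} → i ≢ j → E (vertex i) (vertex j)

mkTriangle : ∀ {E : Fin N → Fin N → Set} {p} → (∀ {a b} → E a b → E b a) → ∀ {x y z} →
  x ∈ p → y ∈ p → z ∈ p → x ≢ y → x ≢ z → y ≢ z → E x y → E x z → E y z → Triangle E p
mkTriangle {E = E} E-sym {x} {y} {z} x∈ y∈ z∈ x≢y x≢z y≢z xy xz yz = triangle (triple x y z)
  (λ { #0 → x∈ ; #1 → y∈ ; #2 → z∈ })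
  (triple-pairwise _≢_ (_∘ sym) x≢y x≢z y≢z)
  (triple-pairwise E E-sym xy xz yz)

threeElements : ∀ (p : Subset N) → 3 ≤ ∣ p ∣ → ∃[ x ] ∃[ y ] ∃[ z ]
  (x ∈ p × y ∈ p × z ∈ p) × x ≢ y × x ≢ z × y ≢ z
threeElements p le =
  let x , x∈       = nonempty p (≤-trans (s≤s z≤n) le)
      y , y∈       = nonempty (p - x) (∣p-x∣≥ p x (≤-trans (s≤s (s≤s z≤n)) le))
      z , z∈       = nonempty (p - x - y) (∣p-x∣≥ (p - x) y (∣p-x∣≥ p x le))
      y∈p , x≢y    = ∈-removeʳ y∈
      z∈p-x , y≢z  = ∈-removeʳ {p = p - x} z∈
      z∈p , x≢z    = ∈-removeʳ z∈p-x
  in  x , y , z , (x∈ , y∈p , z∈p) , x≢y , x≢z , y≢z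

comprehend : ∀ {N} {P : Fin N → Set} → (∀ x → Dec (P x)) → ∃[ s ] (∀ {x} → x ∈ s → P x) × (∀ {x} → P x → x ∈ s)
comprehend {zero}  P? = [] , (λ ()) , λ { {()} }
comprehend {suc N} P? with comprehend (P? ∘ suc) | P? zero
... | s , sound , complete | yes p = inside ∷ s , (λ { here → p ; (there x∈) → sound x∈ })
  , λ { {zero} _ → here ; {suc x} px → there (complete px) }
... | s , sound , complete | no ¬p = outside ∷ s , (λ { (there x∈) → sound x∈ })
  , λ { {zero} p → contradiction p ¬p ; {suc x} px → there (complete px) }

module _ {E : Fin N → Fin N → Set} (E? : ∀ x y → Dec (E x y)) (E-sym : ∀ {x y} → E x y → E y x) where

  -- An edge among three neighbours of `x` closes a triangle with `x`; without such an edge the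
  -- three neighbours are the second outcome.
  star : ∀ (p S : Subset N) {x} → x ∈ p → S ⊆ p → (∀ {s} → s ∈ S → x ≢ s × E x s) → 3 ≤ ∣ S ∣ →
    Triangle E p ⊎ Triangle (λ a b → ¬ E a b) p
  star p S {x} x∈ S⊆p adjacent 3≤∣S∣ = choose (threeElements S 3≤∣S∣)
    where
    choose : (∃[ a ] ∃[ b ] ∃[ d ] (a ∈ S × b ∈ S × d ∈ S) × a ≢ b × a ≢ d × b ≢ d) →
      Triangle E p ⊎ Triangle (λ a b → ¬ E a b) p
    choose (a , b , d , (a∈ , b∈ , d∈) , a≢b , a≢d , b≢d) with E? a b | E? a d | E? b d
    ... | yes ab | _ | _ = inj₁ (mkTriangle E-sym x∈ (S⊆p a∈) (S⊆p b∈)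
      (proj₁ (adjacent a∈)) (proj₁ (adjacent b∈)) a≢b (proj₂ (adjacent a∈)) (proj₂ (adjacent b∈)) ab)
    ... | _ | yes ad | _ = inj₁ (mkTriangle E-sym x∈ (S⊆p a∈) (S⊆p d∈)
      (proj₁ (adjacent a∈)) (proj₁ (adjacent d∈)) a≢d (proj₂ (adjacent a∈)) (proj₂ (adjacent d∈)) ad)
    ... | _ | _ | yes bd = inj₁ (mkTriangle E-sym x∈ (S⊆p b∈) (S⊆p d∈)
      (proj₁ (adjacent b∈)) (proj₁ (adjacent d∈)) b≢d (proj₂ (adjacent b∈)) (proj₂ (adjacent d∈)) bd)
    ... | no ¬ab | no ¬ad | no ¬bd =
      inj₂ (mkTriangle (_∘ E-sym) (S⊆p a∈) (S⊆p b∈) (S⊆p d∈) a≢b a≢d b≢d ¬ab ¬ad ¬bd)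

-- Among the five elements other than `x`, three are neighbours of `x` or three are not; `star`
-- treats either case.
ramsey : ∀ {E : Fin N → Fin N → Set} → (∀ x y → Dec (E x y)) → (∀ {x y} → E x y → E y x) →
  ∀ (p : Subset N) → 6 ≤ ∣ p ∣ → Triangle E p ⊎ Triangle (λ a b → ¬ E a b) p
ramsey {N} {E} E? E-sym p 6≤∣p∣ = split (3 ≤? ∣ S ∣)
  where
  x : Fin N
  x = proj₁ (nonempty p (≤-trans (s≤s z≤n) 6≤∣p∣))

  x∈p : x ∈ p
  x∈p = proj₂ (nonempty p (≤-trans (s≤s z≤n) 6≤∣p∣))

  neighbours : ∃[ S ] (∀ {s} → s ∈ S → s ∈ p - x × E x s) × (∀ {s} → s ∈ p - x × E x s → s ∈ S)
  neighbours = comprehend λ s → (s ∈? (p - x)) ×-dec E? x s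

  S : Subset N
  S = proj₁ neighbours

  split : Dec (3 ≤ ∣ S ∣) → Triangle E p ⊎ Triangle (λ a b → ¬ E a b) p
  split (yes 3≤∣S∣) = star E? E-sym p S x∈p (λ s∈ → proj₁ (∈-removeʳ (adjacent s∈ .proj₁)))
    (λ s∈ → proj₂ (∈-removeʳ {p = p} (adjacent s∈ .proj₁)) , adjacent s∈ .proj₂) 3≤∣S∣
    where
    adjacent : ∀ {s} → s ∈ S → s ∈ p - x × E x s
    adjacent = proj₁ (proj₂ neighbours)
  -- At most two of the five are neighbours, so `star` applies to the complementary relation. Its
  -- second outcome has doubly negated edges.
  split (no 3≰∣S∣) = [ inj₂ , (λ (triangle y y∈ distinct edge) →
      inj₁ (triangle y y∈ distinct λ i≢j → decidable-stable (E? _ _) (edge i≢j))) ]′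
    (star (λ a b → ¬? (E? a b)) (_∘ E-sym) p (p - x ─ S) x∈p
      (λ s∈ → proj₁ (∈-removeʳ (p─q⊆p (p - x) S s∈)))
      (λ s∈ → proj₂ (∈-removeʳ {p = p} (p─q⊆p (p - x) S s∈))
            , λ xs → x∈p─q⇒x∉q (p - x) S s∈ (proj₂ (proj₂ neighbours) (p─q⊆p (p - x) S s∈ , xs)))
      (+-cancelʳ-≤ 2 3 _ (≤-trans (≤-trans (∣p-x∣≥ p x 6≤∣p∣) (∣p∣≤∣p─q∣+∣q∣ (p - x) S))
        (+-monoʳ-≤ _ (≤-pred (≰⇒> 3≰∣S∣))))))

-- The interior of an interval

-- If `X` has `n` elements and is disjoint from `A` and `y`, then `findRed` provides some `U`; the
-- point is whether a small one exists.
Light : Coloring N → Subset N → Subset N → ℕ → Fin N → Set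
Light c A X u y = ∃[ U ] U ⊆ X × ∣ U ∣ ≤ u × c ((A ∪ ⁅ y ⁆) ∪ U) ≡ true

light? : ∀ (c : Coloring N) A X u y → Dec (Light c A X u y)
light? c A X u y = anySubset? λ U → (U ⊆? X) ×-dec (∣ U ∣ ≤? u) ×-dec (c ((A ∪ ⁅ y ⁆) ∪ U) ≟ᵇ true)

meet⇒∣p∪q∣<∣p∣+∣q∣ : ∀ (p q : Subset N) {x} → x ∈ p → x ∈ q → ∣ p ∪ q ∣ < ∣ p ∣ + ∣ q ∣
meet⇒∣p∪q∣<∣p∣+∣q∣ p q {x} x∈p x∈q = begin
  suc ∣ p ∪ q ∣           ≡⟨ +-comm 1 _ ⟩
  ∣ p ∪ q ∣ + 1           ≡⟨ cong (∣ p ∪ q ∣ +_) (sym (∣⁅x⁆∣≡1 x)) ⟩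
  ∣ p ∪ q ∣ + ∣ ⁅ x ⁆ ∣   ≤⟨ +-monoʳ-≤ ∣ p ∪ q ∣ (p⊆q⇒∣p∣≤∣q∣ (⁅⁆⊆ (x∈p∩q⁺ (x∈p , x∈q)))) ⟩
  ∣ p ∪ q ∣ + ∣ p ∩ q ∣   ≡⟨ ∣p∪q∣+∣p∩q∣≡∣p∣+∣q∣ p q ⟩
  ∣ p ∣ + ∣ q ∣           ∎
  where open ≤-Reasoning

-- Sets of size at most u whose pairwise unions have size at least 2u are disjoint of size u.
spreadTriple : ∀ (p q r X : Subset N) u → p ⊆ X → q ⊆ X → r ⊆ X →
  ∣ p ∣ ≤ u → ∣ q ∣ ≤ u → ∣ r ∣ ≤ u → u + u ≤ ∣ p ∪ q ∣ → u + u ≤ ∣ p ∪ r ∣ → u + u ≤ ∣ q ∪ r ∣ →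
  u + u + u ≤ ∣ X ∣
spreadTriple p q r X u p⊆X q⊆X r⊆X ∣p∣≤ ∣q∣≤ ∣r∣≤ pq pr qr = begin
  u + u + u          ≤⟨ +-mono-≤ pq u≤∣r∣ ⟩
  ∣ p ∪ q ∣ + ∣ r ∣  ≤⟨ Disjoint⇒∣p∣+∣q∣≤∣p∪q∣ (p ∪ q) r (∪-disjointˡ p q (apart ∣p∣≤ ∣r∣≤ pr) (apart ∣q∣≤ ∣r∣≤ qr)) ⟩
  ∣ (p ∪ q) ∪ r ∣    ≤⟨ p⊆q⇒∣p∣≤∣q∣ (∪-lub (p ∪ q) r (∪-lub p q p⊆X q⊆X) r⊆X) ⟩
  ∣ X ∣              ∎
  where
  open ≤-Reasoning
  u≤∣r∣ : u ≤ ∣ r ∣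
  u≤∣r∣ = +-cancelˡ-≤ u u _ (≤-trans pr (≤-trans (∣p∪q∣≤∣p∣+∣q∣ p r) (+-monoˡ-≤ ∣ r ∣ ∣p∣≤)))

  apart : ∀ {s t : Subset _} → ∣ s ∣ ≤ u → ∣ t ∣ ≤ u → u + u ≤ ∣ s ∪ t ∣ → Disjoint s t
  apart {s} {t} ∣s∣≤ ∣t∣≤ st x∈s x∈t =
    <⇒≱ (meet⇒∣p∪q∣<∣p∣+∣q∣ s t x∈s x∈t) (≤-trans (+-mono-≤ ∣s∣≤ ∣t∣≤) st)

-- The last index bounds the number of light elements of a free set of dimension n + k.
data Regime (n k u : ℕ) : ℕ → Set where
  tight : u + u + 3 ≤ k → Regime n k u 2
  loose : u + u + 2 ≤ k → n < u + u + u → Regime n k u 5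

-- If all of `Y` were light, `noThreeAtoms` would forbid three elements whose sets `U` have pairwise
-- small unions. In the tight regime any three elements are of this kind. In the loose regime six
-- elements contain such a triple or one with pairwise large unions, which by `spreadTriple` does
-- not fit into `X`.
lightBound : ∀ {c : Coloring N} {A V} → Avoids n c → Interval c A V →
  (R : Subset N) → Disjoint R A → Disjoint R V → n + k ≤ ∣ R ∣ →
  (X : Subset N) → X ⊆ R → ∣ X ∣ ≡ n → ∀ {u ρ} → Regime n k u ρ →
  (Y : Subset N) → Y ⊆ R ─ X → ρ < ∣ Y ∣ → ∃[ y ] y ∈ Y × ¬ Light c A X u y
lightBound {N} {n} {k} {c} {A} {V} avoids I R R∥A R∥V n+k≤∣R∣ X X⊆R ∣X∣≡n {u} {ρ} regime Y Y⊆ ρ<∣Y∣ =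
  search (any? λ y → (y ∈? Y) ×-dec ¬? (light? c A X u y))
  where
  search : Dec (∃[ y ] y ∈ Y × ¬ Light c A X u y) → ∃[ y ] y ∈ Y × ¬ Light c A X u y
  search (yes found) = found
  search (no none)   = contradiction ρ<∣Y∣ (impossible regime)
    where
    choose : ∀ {y} → Dec (Light c A X u y) → Subset N
    choose (yes (U , _)) = U
    -- Not taken on `Y`, whose elements are all light here.
    choose (no _)        = ⊥

    U : Fin N → Subset N
    U y = choose (light? c A X u y)

    U-spec : ∀ {y} → y ∈ Y → U y ⊆ X × ∣ U y ∣ ≤ u × c ((A ∪ ⁅ y ⁆) ∪ U y) ≡ true
    U-spec {y} y∈Y with light? c A X u y
    ... | yes (_ , spec) = spec
    ... | no  ¬light     = contradiction (y , y∈Y , ¬light) none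

    U⊆X : ∀ {y} → y ∈ Y → U y ⊆ X
    U⊆X y∈Y = proj₁ (U-spec y∈Y)

    ∣U∣≤u : ∀ {y} → y ∈ Y → ∣ U y ∣ ≤ u
    ∣U∣≤u y∈Y = proj₁ (proj₂ (U-spec y∈Y))

    Close : Fin N → Fin N → Set
    Close a b = ∣ U a ∪ U b ∣ + 3 ≤ k

    close-sym : ∀ {a b} → Close a b → Close b a
    close-sym {a} {b} = subst (λ s → ∣ s ∣ + 3 ≤ k) (∪-comm (U a) (U b))

    noTriangle : ¬ Triangle Close Y
    noTriangle (triangle y y∈Y distinct edge) = noThreeAtoms avoids I R R∥A R∥V n+k≤∣R∣ y
      (λ i → p─q⊆p R X (Y⊆ (y∈Y i))) distinct (U ∘ y) (λ i → X⊆R ∘ U⊆X (y∈Y i))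
      (λ {i} {j} _ y∈U → x∈p─q⇒x∉q R X (Y⊆ (y∈Y i)) (U⊆X (y∈Y j) y∈U))
      edge (λ i → proj₂ (proj₂ (U-spec (y∈Y i))))

    impossible : ∀ {ρ} → Regime n k u ρ → ¬ (ρ < ∣ Y ∣)
    impossible (tight 2u+3≤k) 3≤∣Y∣ =
      let x , y , z , (x∈ , y∈ , z∈) , x≢y , x≢z , y≢z = threeElements Y 3≤∣Y∣
      in  noTriangle (mkTriangle {E = Close} close-sym x∈ y∈ z∈ x≢y x≢z y≢z (close x∈ y∈) (close x∈ z∈) (close y∈ z∈))
      where
      close : ∀ {a b} → a ∈ Y → b ∈ Y → Close a b
      close {a} {b} a∈ b∈ = ≤-trans
        (+-monoˡ-≤ 3 (≤-trans (∣p∪q∣≤∣p∣+∣q∣ (U a) (U b)) (+-mono-≤ (∣U∣≤u a∈) (∣U∣≤u b∈)))) 2u+3≤k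
    impossible (loose 2u+2≤k n<3u) 6≤∣Y∣ = [ noTriangle , noSpread ]′
      (ramsey (λ a b → ∣ U a ∪ U b ∣ + 3 ≤? k) (λ {a} {b} → close-sym {a} {b}) Y 6≤∣Y∣)
      where
      far : ∀ {a b} → ¬ Close a b → u + u ≤ ∣ U a ∪ U b ∣
      -- Not being close means a union of size at least `k ∸ 2`, and `u + u + 2 ≤ k`.
      far ¬close = +-cancelʳ-≤ 3 _ _ (≤-trans (≤-reflexive (+-suc (u + u) 2))
        (≤-trans (s≤s 2u+2≤k) (≰⇒> ¬close)))

      noSpread : ¬ Triangle (λ a b → ¬ Close a b) Y
      noSpread (triangle y y∈Y _ edge) = <⇒≱ n<3u (subst (u + u + u ≤_) ∣X∣≡n
        (spreadTriple (U (y #0)) (U (y #1)) (U (y #2)) X u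
          (U⊆X (y∈Y #0)) (U⊆X (y∈Y #1)) (U⊆X (y∈Y #2))
          (∣U∣≤u (y∈Y #0)) (∣U∣≤u (y∈Y #1)) (∣U∣≤u (y∈Y #2))
          (far (edge λ ())) (far (edge λ ())) (far (edge λ ()))))

∣⁅x⁆∪⁅y⁆∣≤2 : ∀ (x y : Fin N) → ∣ ⁅ x ⁆ ∪ ⁅ y ⁆ ∣ ≤ 2
∣⁅x⁆∪⁅y⁆∣≤2 x y = ≤-trans (∣p∪q∣≤∣p∣+∣q∣ ⁅ x ⁆ ⁅ y ⁆) (≤-reflexive (cong₂ _+_ (∣⁅x⁆∣≡1 x) (∣⁅x⁆∣≡1 y)))

-- Brings the red top sets of `gapOfTriples` into the form that the dual colouring sees as sets
-- above `V`.
∪-∁ : ∀ (D X Z : Subset N) → Disjoint X D → Z ⊆ X → Z ∪ ∁ (D ∪ X) ≡ ∁ (D ∪ (X ─ Z))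
∪-∁ D X Z X∥D Z⊆X = ⊆-antisym
  (∪-lub Z _ (λ x∈Z → x∉p⇒x∈∁p (∪-disjoint D (X ─ Z) (X∥D ∘ Z⊆X) (λ x∈Z x∈ → x∈p─q⇒x∉q X Z x∈ x∈Z) x∈Z))
             (p⊆q⇒∁p⊇∁q (∪-lub D (X ─ Z) (p⊆p∪q X) (q⊆p∪q D X ∘ p─q⊆p X Z))))
  λ {x} x∈ → x∈p∪q⁺ (cases x (x∈∁p⇒x∉p x∈))
  where
  cases : ∀ x → x ∉ D ∪ (X ─ Z) → x ∈ Z ⊎ x ∈ ∁ (D ∪ X)
  cases x x∉ with x ∈? Z
  ... | yes x∈Z = inj₁ x∈Z
  ... | no  x∉Z = inj₂ (x∉p⇒x∈∁p λ x∈ → x∉ ([ p⊆p∪q (X ─ Z)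
    , (λ x∈X → q⊆p∪q D (X ─ Z) (x∈p∧x∉q⇒x∈p─q x∈X x∉Z)) ]′ (x∈p∪q⁻ D X x∈)))

-- The embedding by triples, started at `A ∪ ⁅ y ⁆` and stopped at the complement of
-- `V ∪ ⁅ y′ ⁆ ∪ X`. The 4 counts `y`, `y′` and the at most two elements left over by the triples.
probe : ∀ {c : Coloring N} {A V} → Avoids n c → Interval c A V →
  (R : Subset N) → Disjoint R A → Disjoint R V → (X : Subset N) → X ⊆ R → ∣ X ∣ ≡ n →
  ∀ {y y′} → y ∈ R ─ X → y′ ∈ R ─ X → y ≢ y′ →
  ∃[ j ] ∃[ A₀ ] ∃[ Z ] A₀ ⊆ X × Z ⊆ X × ∣ A₀ ∣ + j ≤ ∣ Z ∣ × ∣ R ─ X ∣ ≤ 3 * j + 4 ×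
    c ((A ∪ ⁅ y ⁆) ∪ A₀) ≡ true × dual c ((V ∪ ⁅ y′ ⁆) ∪ (X ─ Z)) ≡ true
probe {N} {n} {c} {A} {V} (noRed , noBlue) I R R∥A R∥V X X⊆R ∣X∣≡n {y} {y′} y∈Y y′∈Y y≢y′ =
  let j , A₀ , Z , E , A₀⊆Z , Z⊆X , le , redA₀ , _ , ∣E∣≤2 , ∣Q∣≤ , red =
        gapOfTriples c noRed noBlue P Q X P⊆Q X∥Q (≤-reflexive (sym ∣X∣≡n))
  in  j , A₀ , Z , Z⊆X ∘ A₀⊆Z , Z⊆X , le , ∣Y∣≤ j ∣E∣≤2 ∣Q∣≤
      , subst (λ s → c s ≡ true) (∪-comm A₀ P) redA₀
      , subst (λ s → c s ≡ true) (trans (cong (Z ∪_) (p─⊥≡p Q)) (∪-∁ D X Z X∥D Z⊆X)) (red ⊥⊆)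
  where
  open Interval I
  open ≤-Reasoning

  Y D P Q yy′ : Subset N
  Y   = R ─ X
  D   = V ∪ ⁅ y′ ⁆
  P   = A ∪ ⁅ y ⁆
  Q   = ∁ (D ∪ X)
  yy′ = ⁅ y ⁆ ∪ ⁅ y′ ⁆

  Y⊆R : Y ⊆ R
  Y⊆R = p─q⊆p R X

  Y∥X : Disjoint Y X
  Y∥X = x∈p─q⇒x∉q R X

  X∥D : Disjoint X D
  X∥D = ∪-disjoint V ⁅ y′ ⁆ (R∥V ∘ X⊆R) (disjoint-⁅⁆ (Y∥X y′∈Y))

  P⊆Q : P ⊆ Q
  P⊆Q = ∪-lub A ⁅ y ⁆
    (λ x∈A → x∉p⇒x∈∁p (∪-disjoint D X (∪-disjoint V ⁅ y′ ⁆ A∥V (disjoint-⁅⁆ (R∥A (Y⊆R y′∈Y))))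
      (λ x∈A x∈X → R∥A (X⊆R x∈X) x∈A) x∈A))
    (⁅⁆⊆ (x∉p⇒x∈∁p λ y∈ → [ (λ y∈D → [ R∥V (Y⊆R y∈Y) , y≢y′ ∘ x∈⁅y⁆⇒x≡y y′ ]′ (x∈p∪q⁻ V ⁅ y′ ⁆ y∈D)) , Y∥X y∈Y ]′
      (x∈p∪q⁻ D X y∈)))

  X∥Q : Disjoint X Q
  X∥Q x∈X x∈Q = x∈∁p⇒x∉p x∈Q (q⊆p∪q D X x∈X)

  P∥ : Disjoint P (Y ─ yy′)
  P∥ = ∪-disjointˡ A ⁅ y ⁆ (λ x∈A x∈ → R∥A (Y⊆R (p─q⊆p Y yy′ x∈)) x∈A)
    (⁅⁆-disjoint λ y∈ → x∈p─q⇒x∉q Y yy′ y∈ (p⊆p∪q ⁅ y′ ⁆ (x∈⁅x⁆ y)))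

  rest⊆Q : Y ─ yy′ ⊆ Q
  rest⊆Q x∈ = x∉p⇒x∈∁p (∪-disjoint D X
    (∪-disjoint V ⁅ y′ ⁆ (R∥V ∘ Y⊆R ∘ p─q⊆p Y yy′)
      (disjoint-⁅⁆ λ y′∈ → x∈p─q⇒x∉q Y yy′ y′∈ (q⊆p∪q ⁅ y ⁆ ⁅ y′ ⁆ (x∈⁅x⁆ y′))))
    (Y∥X ∘ p─q⊆p Y yy′) x∈)

  ∣P∣+∣Y∣≤∣Q∣+2 : ∣ P ∣ + ∣ Y ∣ ≤ ∣ Q ∣ + 2
  ∣P∣+∣Y∣≤∣Q∣+2 = begin
    ∣ P ∣ + ∣ Y ∣                        ≤⟨ +-monoʳ-≤ ∣ P ∣ (∣p∣≤∣p─q∣+∣q∣ Y yy′) ⟩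
    ∣ P ∣ + (∣ Y ─ yy′ ∣ + ∣ yy′ ∣)      ≡⟨ +-assoc ∣ P ∣ _ _ ⟨
    ∣ P ∣ + ∣ Y ─ yy′ ∣ + ∣ yy′ ∣        ≤⟨ +-mono-≤ (≤-trans (Disjoint⇒∣p∣+∣q∣≤∣p∪q∣ P (Y ─ yy′) P∥)
                                                            (p⊆q⇒∣p∣≤∣q∣ (∪-lub P _ P⊆Q rest⊆Q)))
                                                   (∣⁅x⁆∪⁅y⁆∣≤2 y y′) ⟩
    ∣ Q ∣ + 2                            ∎

  ∣Y∣≤ : ∀ j {e} → e ≤ 2 → ∣ Q ∣ ≤ ∣ P ∣ + (3 * j + e) → ∣ Y ∣ ≤ 3 * j + 4
  ∣Y∣≤ j {e} e≤2 ∣Q∣≤ = +-cancelˡ-≤ ∣ P ∣ _ _ (begin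
    ∣ P ∣ + ∣ Y ∣                ≤⟨ ∣P∣+∣Y∣≤∣Q∣+2 ⟩
    ∣ Q ∣ + 2                    ≤⟨ +-monoˡ-≤ 2 (≤-trans ∣Q∣≤ (+-monoʳ-≤ ∣ P ∣ (+-monoʳ-≤ (3 * j) e≤2))) ⟩
    ∣ P ∣ + (3 * j + 2) + 2      ≡⟨ +-assoc ∣ P ∣ _ 2 ⟩
    ∣ P ∣ + (3 * j + 2 + 2)      ≡⟨ cong (∣ P ∣ +_) (+-assoc (3 * j) 2 2) ⟩
    ∣ P ∣ + (3 * j + 4)          ∎)

-- Take `y` not light from below and `y′` not light from above. Then the probe has `A₀` and `X ─ Z`
-- of more than `u` elements each and `j` at least `d`, too much for the `n` elements of `X`. The
-- bound `ρ + 2 ≤ k` leaves more than `ρ` candidates for `y′` after `y` is removed.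
interior : ∀ {c : Coloring N} {A V} → Avoids n c → Interval c A V →
  (R : Subset N) → Disjoint R A → Disjoint R V →
  ∀ {u ρ d} → Regime n k u ρ → ρ + 2 ≤ k → 3 * d + 2 ≤ k → n < u + u + 2 + d → ¬ (n + k ≤ ∣ R ∣)
interior {N} {n} {k} {c} {A} {V} avoids I R R∥A R∥V {u} {ρ} {d} regime ρ+2≤k 3d+2≤k n< n+k≤∣R∣ =
  let j , A₀ , Z , A₀⊆X , Z⊆X , le , ∣Y∣≤ , redA₀ , redZ =
        probe avoids I R R∥A R∥V X X⊆R ∣X∣≡n y∈Y y′∈Y y≢y′
      u<∣A₀∣  = ≰⇒> λ ∣A₀∣≤u → proj₂ (proj₂ heavy) (A₀ , A₀⊆X , ∣A₀∣≤u , redA₀)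
      u<∣X─Z∣ = ≰⇒> λ ∣X─Z∣≤u → proj₂ (proj₂ heavy′) (X ─ Z , p─q⊆p X Z , ∣X─Z∣≤u , redZ)
  in  <⇒≱ n< (begin
        u + u + 2 + d              ≡⟨ cong (_+ d) (2u+2 u) ⟩
        suc u + suc u + d          ≤⟨ +-mono-≤ (+-mono-≤ u<∣X─Z∣ u<∣A₀∣) (d≤j j ∣Y∣≤) ⟩
        ∣ X ─ Z ∣ + ∣ A₀ ∣ + j     ≡⟨ +-assoc ∣ X ─ Z ∣ ∣ A₀ ∣ j ⟩
        ∣ X ─ Z ∣ + (∣ A₀ ∣ + j)   ≤⟨ +-monoʳ-≤ ∣ X ─ Z ∣ le ⟩
        ∣ X ─ Z ∣ + ∣ Z ∣          ≤⟨ p⊆q⇒∣q─p∣+∣p∣≤∣q∣ Z⊆X ⟩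
        ∣ X ∣                      ≡⟨ ∣X∣≡n ⟩
        n                          ∎)
  where
  open ≤-Reasoning

  2u+2 : ∀ u → u + u + 2 ≡ suc u + suc u
  2u+2 = solve-∀

  sub : ∃[ X ] X ⊆ R × ∣ X ∣ ≡ n
  sub = subsetOfSize R (≤-trans (m≤m+n n k) n+k≤∣R∣)

  X Y : Subset N
  X = proj₁ sub
  Y = R ─ X

  X⊆R : X ⊆ R
  X⊆R = proj₁ (proj₂ sub)

  ∣X∣≡n : ∣ X ∣ ≡ n
  ∣X∣≡n = proj₂ (proj₂ sub)

  k≤∣Y∣ : k ≤ ∣ Y ∣
  k≤∣Y∣ = +-cancelˡ-≤ n k _ (≤-trans n+k≤∣R∣ (≤-trans (∣p∣≤∣p─q∣+∣q∣ R X)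
    (≤-reflexive (trans (cong (∣ Y ∣ +_) ∣X∣≡n) (+-comm ∣ Y ∣ n)))))

  ρ+2≤∣Y∣ : suc (suc ρ) ≤ ∣ Y ∣
  ρ+2≤∣Y∣ = ≤-trans (≤-reflexive (+-comm 2 ρ)) (≤-trans ρ+2≤k k≤∣Y∣)

  heavy : ∃[ y ] y ∈ Y × ¬ Light c A X u y
  heavy = lightBound avoids I R R∥A R∥V n+k≤∣R∣ X X⊆R ∣X∣≡n regime Y id (≤-trans (n≤1+n _) ρ+2≤∣Y∣)

  y : Fin N
  y = proj₁ heavy

  y∈Y : y ∈ Y
  y∈Y = proj₁ (proj₂ heavy)

  heavy′ : ∃[ y′ ] y′ ∈ Y - y × ¬ Light (dual c) V X u y′
  heavy′ = lightBound (avoids-dual {c = c} avoids) (interval-dual I) R R∥V R∥A n+k≤∣R∣ X X⊆R ∣X∣≡n regime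
    (Y - y) (proj₁ ∘ ∈-removeʳ) (∣p-x∣≥ Y y ρ+2≤∣Y∣)

  y′ : Fin N
  y′ = proj₁ heavy′

  y′∈Y : y′ ∈ Y
  y′∈Y = proj₁ (∈-removeʳ {p = Y} (proj₁ (proj₂ heavy′)))

  y≢y′ : y ≢ y′
  y≢y′ = proj₂ (∈-removeʳ {p = Y} (proj₁ (proj₂ heavy′)))

  -- From `3 * d + 2 ≤ 3 * j + 4`, the excess 2 being less than a full triple.
  d≤j : ∀ j → ∣ Y ∣ ≤ 3 * j + 4 → d ≤ j
  d≤j j ∣Y∣≤ = ≤-pred (*-cancelˡ-< 3 d (suc j) (+-cancelʳ-< 2 (3 * d) (3 * suc j)
    (≤-trans (s≤s (≤-trans 3d+2≤k (≤-trans k≤∣Y∣ ∣Y∣≤))) (≤-reflexive (3j+5 j)))))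
    where
    3j+5 : ∀ j → suc (3 * j + 4) ≡ 3 * suc j + 2
    3j+5 = solve-∀

-- Two of the three coatoms are ∁ (V ∪ ⁅ e₁ ⁆) and ∁ (V ∪ ⁅ e₂ ⁆), and the third atom is ∁ (V ∪ ⁅ e₁ ⁆ ∪ ⁅ e₂ ⁆).
module PairedTop {c : Coloring N} {A V : Subset N} (avoids : Avoids n c) (I : Interval c A V)
  (R : Subset N) (R∥A : Disjoint R A) (R∥V : Disjoint R V)
  {e₁ e₂ : Fin N} (e₁∈R : e₁ ∈ R) (e₂∈R : e₂ ∈ R) (e₁≢e₂ : e₁ ≢ e₂)
  (red₁ : c (∁ (V ∪ ⁅ e₁ ⁆)) ≡ true) (red₂ : c (∁ (V ∪ ⁅ e₂ ⁆)) ≡ true)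
  (red₁₂ : c (∁ (V ∪ (⁅ e₁ ⁆ ∪ ⁅ e₂ ⁆))) ≡ true) where

  open Interval I

  G : Subset N
  G = ⁅ e₁ ⁆ ∪ ⁅ e₂ ⁆

  e₁∈G : e₁ ∈ G
  e₁∈G = p⊆p∪q ⁅ e₂ ⁆ (x∈⁅x⁆ e₁)

  e₂∈G : e₂ ∈ G
  e₂∈G = q⊆p∪q ⁅ e₁ ⁆ ⁅ e₂ ⁆ (x∈⁅x⁆ e₂)

  G⊆R : G ⊆ R
  G⊆R = ∪-lub ⁅ e₁ ⁆ ⁅ e₂ ⁆ (⁅⁆⊆ e₁∈R) (⁅⁆⊆ e₂∈R)

  ∥G⇒∌ : ∀ {p e} → p ⊆ R ─ G → e ∈ G → e ∉ p
  ∥G⇒∌ p⊆ e∈G e∈p = x∈p─q⇒x∉q R G (p⊆ e∈p) e∈G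

  -- The top pair provides two coatoms and an atom, so only two atoms and a coatom remain to be
  -- found, and `U` only has to be disjoint from `Z₁` and `Z₂`. The point `u` keeps the third atom
  -- out of the third coatom.
  noFace : ∀ {Z₁ Z₂ U u} → Z₁ ⊆ R ─ G → Z₂ ⊆ R ─ G → U ⊆ R ─ G → Disjoint Z₁ U → Disjoint Z₂ U → u ∈ U →
    c ((A ∪ ⁅ e₁ ⁆) ∪ Z₁) ≡ true → c ((A ∪ ⁅ e₂ ⁆) ∪ Z₂) ≡ true → ¬ (c (∁ (V ∪ U)) ≡ true)
  noFace {Z₁} {Z₂} {U} {u} Z₁⊆ Z₂⊆ U⊆ Z₁∥U Z₂∥U u∈U redZ₁ redZ₂ redU = proj₁ avoids (redCube c A (∁ V)
    (triple P₁ P₂ P₃) (triple C₁ C₂ C₃) (triple e₁ e₂ u)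
    (λ { #0 → p⊆p∪q Z₁ ∘ p⊆p∪q ⁅ e₁ ⁆
       ; #1 → p⊆p∪q Z₂ ∘ p⊆p∪q ⁅ e₂ ⁆
       ; #2 x∈A → x∉p⇒x∈∁p (∪-disjoint V G A∥V (λ x∈A x∈G → R∥A (G⊆R x∈G) x∈A) x∈A) })
    (λ { {#0} {#0} i≢j → contradiction refl i≢j
       ; {#0} {#1} _ x∈ → x∉p⇒x∈∁p (atom∥ e₁∈R Z₁⊆ ⁅ e₂ ⁆ (disjoint-⁅⁆ (λ e₂∈A → R∥A e₂∈R e₂∈A))
           (e₁≢e₂ ∘ x∈⁅y⁆⇒x≡y e₂) (disjoint-⁅⁆ (∥G⇒∌ Z₁⊆ e₂∈G)) x∈)
       ; {#0} {#2} _ x∈ → x∉p⇒x∈∁p (atom∥ e₁∈R Z₁⊆ U A∥U (∥G⇒∌ U⊆ e₁∈G) Z₁∥U x∈)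
       ; {#1} {#0} _ x∈ → x∉p⇒x∈∁p (atom∥ e₂∈R Z₂⊆ ⁅ e₁ ⁆ (disjoint-⁅⁆ (λ e₁∈A → R∥A e₁∈R e₁∈A))
           (e₁≢e₂ ∘ sym ∘ x∈⁅y⁆⇒x≡y e₁) (disjoint-⁅⁆ (∥G⇒∌ Z₂⊆ e₁∈G)) x∈)
       ; {#1} {#1} i≢j → contradiction refl i≢j
       ; {#1} {#2} _ x∈ → x∉p⇒x∈∁p (atom∥ e₂∈R Z₂⊆ U A∥U (∥G⇒∌ U⊆ e₂∈G) Z₂∥U x∈)
       ; {#2} {#0} _ → p⊆q⇒∁p⊇∁q (∪-lub V ⁅ e₁ ⁆ (p⊆p∪q G) (q⊆p∪q V G ∘ p⊆p∪q ⁅ e₂ ⁆))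
       ; {#2} {#1} _ → p⊆q⇒∁p⊇∁q (∪-lub V ⁅ e₂ ⁆ (p⊆p∪q G) (q⊆p∪q V G ∘ q⊆p∪q ⁅ e₁ ⁆ ⁅ e₂ ⁆))
       ; {#2} {#2} i≢j → contradiction refl i≢j })
    (λ { #0 → p⊆q⇒∁p⊇∁q (p⊆p∪q ⁅ e₁ ⁆) ; #1 → p⊆q⇒∁p⊇∁q (p⊆p∪q ⁅ e₂ ⁆) ; #2 → p⊆q⇒∁p⊇∁q (p⊆p∪q U) })
    (λ { #0 → p⊆p∪q Z₁ (q⊆p∪q A ⁅ e₁ ⁆ (x∈⁅x⁆ e₁))
       ; #1 → p⊆p∪q Z₂ (q⊆p∪q A ⁅ e₂ ⁆ (x∈⁅x⁆ e₂))
       ; #2 → x∉p⇒x∈∁p (∪-disjoint V G (R∥V ∘ p─q⊆p R G ∘ U⊆) (x∈p─q⇒x∉q R G ∘ U⊆) u∈U) })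
    (λ { #0 e∈ → x∈∁p⇒x∉p e∈ (q⊆p∪q V ⁅ e₁ ⁆ (x∈⁅x⁆ e₁))
       ; #1 e∈ → x∈∁p⇒x∉p e∈ (q⊆p∪q V ⁅ e₂ ⁆ (x∈⁅x⁆ e₂))
       ; #2 u∈ → x∈∁p⇒x∉p u∈ (q⊆p∪q V U u∈U) })
    redBottom (λ { #0 → redZ₁ ; #1 → redZ₂ ; #2 → red₁₂ }) (λ { #0 → red₁ ; #1 → red₂ ; #2 → redU }) redTop)
    where
    P₁ P₂ P₃ C₁ C₂ C₃ : Subset N
    P₁ = (A ∪ ⁅ e₁ ⁆) ∪ Z₁
    P₂ = (A ∪ ⁅ e₂ ⁆) ∪ Z₂
    P₃ = ∁ (V ∪ G)
    C₁ = ∁ (V ∪ ⁅ e₁ ⁆)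
    C₂ = ∁ (V ∪ ⁅ e₂ ⁆)
    C₃ = ∁ (V ∪ U)

    A∥U : Disjoint A U
    A∥U x∈A x∈U = R∥A (p─q⊆p R G (U⊆ x∈U)) x∈A

    atom∥ : ∀ {e Z} → e ∈ R → Z ⊆ R ─ G → (q : Subset N) → Disjoint A q → e ∉ q → Disjoint Z q →
      Disjoint ((A ∪ ⁅ e ⁆) ∪ Z) (V ∪ q)
    atom∥ {e} {Z} e∈R Z⊆ q A∥q e∉q Z∥q = ∪-disjoint V q
      (∪-disjointˡ (A ∪ ⁅ e ⁆) Z (∪-disjointˡ A ⁅ e ⁆ A∥V (⁅⁆-disjoint (R∥V e∈R))) (R∥V ∘ p─q⊆p R G ∘ Z⊆))
      (∪-disjointˡ (A ∪ ⁅ e ⁆) Z (∪-disjointˡ A ⁅ e ⁆ A∥q (⁅⁆-disjoint e∉q)) Z∥q)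

  ∣R∣≤∣R─G∪S∣ : ∀ S → ∣ R ∣ ≤ ∣ R ─ (G ∪ S) ∣ + (2 + ∣ S ∣)
  ∣R∣≤∣R─G∪S∣ S = ≤-trans (∣p∣≤∣p─q∣+∣q∣ R (G ∪ S))
    (+-monoʳ-≤ _ (≤-trans (∣p∪q∣≤∣p∣+∣q∣ G S) (+-monoˡ-≤ ∣ S ∣ (∣⁅x⁆∪⁅y⁆∣≤2 e₁ e₂))))

  R─G∪S⊆R─G : ∀ S → R ─ (G ∪ S) ⊆ R ─ G
  R─G∪S⊆R─G S x∈ = x∈p∧x∉q⇒x∈p─q (p─q⊆p R (G ∪ S) x∈) (x∈p─q⇒x∉q R (G ∪ S) x∈ ∘ p⊆p∪q S)

  R─G∪S∥S : ∀ S → Disjoint (R ─ (G ∪ S)) S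
  R─G∪S∥S S x∈ = x∈p─q⇒x∉q R (G ∪ S) x∈ ∘ q⊆p∪q G S

  -- A smaller `U` would leave `n` elements outside `G ∪ U`, enough to find both missing atoms there
  -- and contradict `noFace`.
  coatomBound : n + k ≤ ∣ R ∣ → ∀ {U u} → U ⊆ R ─ G → u ∈ U → c (∁ (V ∪ U)) ≡ true → k < 2 + ∣ U ∣
  coatomBound {k} n+k≤ {U} U⊆ u∈U redU = ≰⇒> λ 2+∣U∣≤k →
    let n≤ = +-cancelʳ-≤ k n _ (≤-trans n+k≤ (≤-trans (∣R∣≤∣R─G∪S∣ U) (+-monoʳ-≤ _ 2+∣U∣≤k)))
        atom : ∀ {e} → e ∈ G → ∃[ Z ] Z ⊆ R ─ (G ∪ U) × c ((A ∪ ⁅ e ⁆) ∪ Z) ≡ true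
        atom {e} e∈G = findRed c (proj₂ avoids) (A ∪ ⁅ e ⁆) (R ─ (G ∪ U))
          (∪-disjoint A ⁅ e ⁆ (R∥A ∘ p─q⊆p R (G ∪ U)) (disjoint-⁅⁆ (∥G⇒∌ (R─G∪S⊆R─G U) e∈G))) n≤
        Z₁ , Z₁⊆ , redZ₁ = atom e₁∈G
        Z₂ , Z₂⊆ , redZ₂ = atom e₂∈G
    in  noFace (R─G∪S⊆R─G U ∘ Z₁⊆) (R─G∪S⊆R─G U ∘ Z₂⊆) U⊆ (R─G∪S∥S U ∘ Z₁⊆) (R─G∪S∥S U ∘ Z₂⊆) u∈U redZ₁ redZ₂ redU

  -- Two light atoms leave room for the coatom. The 3 counts the two elements of `G` and an element
  -- `t` chosen beforehand to make `U` nonempty.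
  notBothLight : ∀ {X u} → n + k ≤ ∣ R ∣ → X ⊆ R ─ G → u + u + 3 ≤ k →
    Light c A X u e₁ → ¬ Light c A X u e₂
  notBothLight {k} {X} {u} n+k≤ X⊆ 2u+3≤k (Z₁ , Z₁⊆X , ∣Z₁∣≤u , redZ₁) (Z₂ , Z₂⊆X , ∣Z₂∣≤u , redZ₂) =
    let t , t∈        = nonempty R₀ (≤-trans (s≤s z≤n) n<∣R₀∣)
        W , W⊆ , redW = findRed (dual c) (proj₂ avoids ∘ dualCopy c false) (V ∪ ⁅ t ⁆) (R₀ - t)
          (∪-disjoint V ⁅ t ⁆ (R∥V ∘ p─q⊆p R _ ∘ p─q⊆p R₀ ⁅ t ⁆) (x∈p─q⇒x∉q R₀ ⁅ t ⁆))
          (∣p-x∣≥ R₀ t n<∣R₀∣)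
        U⊆R₀ : ⁅ t ⁆ ∪ W ⊆ R₀
        U⊆R₀ = ∪-lub ⁅ t ⁆ W (⁅⁆⊆ t∈) (p─q⊆p R₀ ⁅ t ⁆ ∘ W⊆)
    in  noFace (X⊆ ∘ Z₁⊆X) (X⊆ ∘ Z₂⊆X) (R─G∪S⊆R─G (Z₁ ∪ Z₂) ∘ U⊆R₀)
          (λ x∈Z₁ x∈U → R─G∪S∥S (Z₁ ∪ Z₂) (U⊆R₀ x∈U) (p⊆p∪q Z₂ x∈Z₁))
          (λ x∈Z₂ x∈U → R─G∪S∥S (Z₁ ∪ Z₂) (U⊆R₀ x∈U) (q⊆p∪q Z₁ Z₂ x∈Z₂))
          (p⊆p∪q W (x∈⁅x⁆ t)) redZ₁ redZ₂ (subst (λ s → c (∁ s) ≡ true) (∪-assoc V ⁅ t ⁆ W) redW)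
    where
    open ≤-Reasoning
    R₀ : Subset N
    R₀ = R ─ (G ∪ (Z₁ ∪ Z₂))

    n<∣R₀∣ : n < ∣ R₀ ∣
    n<∣R₀∣ = +-cancelʳ-≤ (u + u + 2) (suc n) _ (begin
      suc n + (u + u + 2)               ≡⟨ +-suc n (u + u + 2) ⟨
      n + suc (u + u + 2)               ≡⟨ cong (n +_) (sym (+-suc (u + u) 2)) ⟩
      n + (u + u + 3)                   ≤⟨ +-monoʳ-≤ n 2u+3≤k ⟩
      n + k                             ≤⟨ n+k≤ ⟩
      ∣ R ∣                             ≤⟨ ∣R∣≤∣R─G∪S∣ (Z₁ ∪ Z₂) ⟩
      ∣ R₀ ∣ + (2 + ∣ Z₁ ∪ Z₂ ∣)        ≤⟨ +-monoʳ-≤ ∣ R₀ ∣ (+-monoʳ-≤ 2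
                                            (≤-trans (∣p∪q∣≤∣p∣+∣q∣ Z₁ Z₂) (+-mono-≤ ∣Z₁∣≤u ∣Z₂∣≤u))) ⟩
      ∣ R₀ ∣ + (2 + (u + u))            ≡⟨ cong (∣ R₀ ∣ +_) (+-comm 2 (u + u)) ⟩
      ∣ R₀ ∣ + (u + u + 2)              ∎)

  -- Both `e₁` and `e₂` are light, against `notBothLight`: a probe from an `e` that is not light has
  -- `A₀` of more than `u` elements, and its top is a third coatom, so `coatomBound` makes `X ─ Z`
  -- have at least `k ∸ 2`. Together these exceed `n`.
  pairedTop : ∀ {u} → u + u + 3 ≤ k → n + 2 ≤ k + u → ¬ (n + k ≤ ∣ R ∣)
  pairedTop {k} {u} 2u+3≤k n+2≤k+u n+k≤ = notBothLight n+k≤ X⊆ 2u+3≤k (refute e₁∈G) (refute e₂∈G)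
    where
    open ≤-Reasoning
    sub : ∃[ X ] X ⊆ R ─ G × ∣ X ∣ ≡ n
    sub = subsetOfSize (R ─ G) (+-cancelʳ-≤ 2 n _ (begin
      n + 2                  ≤⟨ +-monoʳ-≤ n (≤-trans (≤-trans (n≤1+n 2) (m≤n+m 3 (u + u))) 2u+3≤k) ⟩
      n + k                  ≤⟨ n+k≤ ⟩
      ∣ R ∣                  ≤⟨ ∣p∣≤∣p─q∣+∣q∣ R G ⟩
      ∣ R ─ G ∣ + ∣ G ∣      ≤⟨ +-monoʳ-≤ _ (∣⁅x⁆∪⁅y⁆∣≤2 e₁ e₂) ⟩
      ∣ R ─ G ∣ + 2          ∎))

    X R₁ : Subset N
    X = proj₁ sub
    R₁ = R ─ (G ∪ X)

    X⊆ : X ⊆ R ─ G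
    X⊆ = proj₁ (proj₂ sub)

    ∣X∣≡n : ∣ X ∣ ≡ n
    ∣X∣≡n = proj₂ (proj₂ sub)

    exists-y : Nonempty R₁
    exists-y = nonempty R₁ (+-cancelʳ-≤ (2 + n) 1 _ (begin
      1 + (2 + n)                ≡⟨ +-comm 3 n ⟩
      n + 3                      ≤⟨ +-monoʳ-≤ n (≤-trans (m≤n+m 3 (u + u)) 2u+3≤k) ⟩
      n + k                      ≤⟨ n+k≤ ⟩
      ∣ R ∣                      ≤⟨ ∣R∣≤∣R─G∪S∣ X ⟩
      ∣ R₁ ∣ + (2 + ∣ X ∣)       ≡⟨ cong (λ m → ∣ R₁ ∣ + (2 + m)) ∣X∣≡n ⟩
      ∣ R₁ ∣ + (2 + n)           ∎))

    refute : ∀ {e} → e ∈ G → Light c A X u e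
    refute {e} e∈G = decidable-stable (light? c A X u e) λ ¬light →
      let y , y∈ = exists-y
          j , A₀ , Z , A₀⊆X , Z⊆X , le , _ , redA₀ , redZ = probe avoids I R R∥A R∥V X (p─q⊆p R G ∘ X⊆) ∣X∣≡n
            (x∈p∧x∉q⇒x∈p─q (G⊆R e∈G) (∥G⇒∌ X⊆ e∈G))
            (x∈p∧x∉q⇒x∈p─q (p─q⊆p R (G ∪ X) y∈) (R─G∪S∥S X y∈))
            (λ { refl → ∥G⇒∌ (R─G∪S⊆R─G X) e∈G y∈ })
          u<∣A₀∣ = ≰⇒> λ ∣A₀∣≤u → ¬light (A₀ , A₀⊆X , ∣A₀∣≤u , redA₀)
          k<     = coatomBound n+k≤ {⁅ y ⁆ ∪ (X ─ Z)}
                     (∪-lub ⁅ y ⁆ (X ─ Z) (⁅⁆⊆ (R─G∪S⊆R─G X y∈)) (X⊆ ∘ p─q⊆p X Z))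
                     (p⊆p∪q (X ─ Z) (x∈⁅x⁆ y))
                     (subst (λ s → c (∁ s) ≡ true) (∪-assoc V ⁅ y ⁆ (X ─ Z)) redZ)
          k≤     = ≤-pred (≤-trans k< (+-monoʳ-≤ 2 (≤-trans (∣p∪q∣≤∣p∣+∣q∣ ⁅ y ⁆ (X ─ Z))
                     (+-monoˡ-≤ ∣ X ─ Z ∣ (≤-reflexive (∣⁅x⁆∣≡1 y))))))
      in  1+n≰n (begin
        suc (n + 2)                    ≤⟨ s≤s n+2≤k+u ⟩
        suc (k + u)                    ≡⟨ +-suc k u ⟨
        k + suc u                      ≤⟨ +-mono-≤ k≤ (≤-trans u<∣A₀∣ (≤-trans (m≤m+n ∣ A₀ ∣ j) le)) ⟩
        2 + (∣ X ─ Z ∣ + ∣ Z ∣)        ≤⟨ +-monoʳ-≤ 2 (p⊆q⇒∣q─p∣+∣p∣≤∣q∣ Z⊆X) ⟩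
        2 + ∣ X ∣                      ≡⟨ cong (2 +_) ∣X∣≡n ⟩
        2 + n                          ≡⟨ +-comm 2 n ⟩
        n + 2                          ∎)

-- The main argument

∁p─q≡∁[q∪p] : ∀ (p q : Subset N) → ∁ p ─ q ≡ ∁ (q ∪ p)
∁p─q≡∁[q∪p] p q = ⊆-antisym
  (λ x∈ → x∉p⇒x∈∁p λ x∈q∪p →
    [ x∈p─q⇒x∉q (∁ p) q x∈ , x∈∁p⇒x∉p (p─q⊆p (∁ p) q x∈) ]′ (x∈p∪q⁻ q p x∈q∪p))
  (λ x∈ → x∈p∧x∉q⇒x∈p─q (x∉p⇒x∈∁p (x∈∁p⇒x∉p x∈ ∘ q⊆p∪q q p)) (x∈∁p⇒x∉p x∈ ∘ p⊆p∪q p))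

n≤∣∁p∣+∣p∣ : ∀ (p : Subset N) → N ≤ ∣ ∁ p ∣ + ∣ p ∣
n≤∣∁p∣+∣p∣ {N} p = ≤-reflexive (sym (trans (cong (_+ ∣ p ∣) (∣∁p∣≡n∸∣p∣ p)) (m∸n+n≡m (∣p∣≤n p))))

-- The unprimed parameters are those of interior, the primed ones those of pairedTop; j₁ and j₂ are the
-- least possible gaps when at most one, respectively two, elements are left over by the triples.
Fits : (n m k u d j₁ k′ u′ j₂ : ℕ) → Set
Fits n m k u d j₁ k′ u′ j₂ =
  16 * (n + m) ≤ 37 * n + 39 ×
  3 * j₁ ≤ m + 1 × n + k ≤ m + j₁ × 4 ≤ k × 3 * d + 2 ≤ k × n < u + u + 2 + d ×
  (u + u + 3 ≤ k ⊎ 7 ≤ k × u + u + 2 ≤ k × n < u + u + u) ×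
  3 * j₂ ≤ m × n + k′ ≤ m + j₂ × u′ + u′ + 3 ≤ k′ × n + 2 ≤ k′ + u′

-- Rounding: when at most `2 ∸ e` of the `m` elements are left over, the number of triples is at
-- least the integer quotient of `m + e` by 3.
quotient-≤ : ∀ {i j m e} → 3 * j ≤ m + e → m ≤ 3 * i + (2 ∸ e) → e ≤ 2 → j ≤ i
quotient-≤ {i} {j} {m} {e} 3j≤ m≤ e≤2 = ≤-pred (*-cancelˡ-< 3 j (suc i) (begin-strict
  3 * j                        ≤⟨ 3j≤ ⟩
  m + e                        ≤⟨ +-monoˡ-≤ e m≤ ⟩
  3 * i + (2 ∸ e) + e          ≡⟨ trans (+-assoc (3 * i) _ e) (cong (3 * i +_) (m∸n+n≡m e≤2)) ⟩
  3 * i + 2                    <⟨ n<1+n _ ⟩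
  suc (3 * i + 2)              ≡⟨ 3i+3 i ⟩
  3 * suc i                    ∎))
  where
  open ≤-Reasoning
  3i+3 : ∀ i → suc (3 * i + 2) ≡ 3 * suc i
  3i+3 = solve-∀

-- The first embedding yields an interval of dimension at least `m + j`. At most one leftover
-- element forces a larger `j`, which `interior` needs; two leftover elements supply the red sets
-- for `pairedTop`, which manages with the smaller one.
unavoidable : ∀ n m {k u d j₁ k′ u′ j₂} → Fits n m k u d j₁ k′ u′ j₂ → (c : Coloring (n + m)) → ¬ Avoids n c
unavoidable n m {k} {u} {d} {j₁} {k′} {u′} {j₂}
  (_ , 3j₁≤ , n+k≤ , 4≤k , 3d+2≤k , n< , regime , 3j₂≤ , n+k′≤ , 2u′+3≤k′ , n+2≤) c avoids =
  cases (gapOfTriples c (proj₁ avoids) (proj₂ avoids) ⊥ (∁ X) X ⊥⊆ x∈p⇒x∉∁p (≤-reflexive (sym ∣X∣≡n)))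
  where
  open ≤-Reasoning
  N′ : ℕ
  N′ = n + m

  sub : ∃[ X ] X ⊆ ⊤ × ∣ X ∣ ≡ n
  sub = subsetOfSize {N′} ⊤ (≤-trans (m≤m+n n m) (≤-reflexive (sym (∣⊤∣≡n N′))))

  X : Subset N′
  X = proj₁ sub

  ∣X∣≡n : ∣ X ∣ ≡ n
  ∣X∣≡n = proj₂ (proj₂ sub)

  m≤∣∁X∣ : m ≤ ∣ ∁ X ∣
  m≤∣∁X∣ = +-cancelʳ-≤ n m _ (begin
    m + n                ≡⟨ +-comm m n ⟩
    n + m                ≤⟨ n≤∣∁p∣+∣p∣ X ⟩
    ∣ ∁ X ∣ + ∣ X ∣      ≡⟨ cong (∣ ∁ X ∣ +_) ∣X∣≡n ⟩
    ∣ ∁ X ∣ + n          ∎)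

  cases : ¬ TripleGap c X ⊥ (∁ X)
  cases (j , A , Z , E , A⊆Z , Z⊆X , ∣A∣+j≤∣Z∣ , redA , E⊆∁X , ∣E∣≤2 , ∣∁X∣≤ , red) = split (2 ≤? ∣ E ∣)
    where
    V R : Subset N′
    V = X ─ Z
    R = ∁ (A ∪ V)

    V⊆X : V ⊆ X
    V⊆X = p─q⊆p X Z

    -- The empty `S` gives the red top; two elements of `E` give the two coatoms and the atom that
    -- `PairedTop` asks for.
    red′ : ∀ {S} → S ⊆ E → c (∁ (V ∪ S)) ≡ true
    red′ {S} S⊆E = subst (λ s → c s ≡ true) (trans (cong (Z ∪_) (∁p─q≡∁[q∪p] X S))
      (trans (∪-∁ S X Z (λ x∈X x∈S → x∈p⇒x∉∁p x∈X (E⊆∁X (S⊆E x∈S))) Z⊆X) (cong ∁ (∪-comm S V)))) (red S⊆E)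

    interval : Interval c A V
    interval = record
      { A∥V       = λ x∈A x∈V → x∈p─q⇒x∉q X Z x∈V (A⊆Z x∈A)
      ; redBottom = subst (λ s → c s ≡ true) (∪-identityʳ A) redA
      ; redTop    = subst (λ s → c (∁ s) ≡ true) (∪-identityʳ V) (red′ ⊥⊆)
      }

    R∥A : Disjoint R A
    R∥A x∈R = x∈∁p⇒x∉p x∈R ∘ p⊆p∪q V

    R∥V : Disjoint R V
    R∥V x∈R = x∈∁p⇒x∉p x∈R ∘ q⊆p∪q A V

    E⊆R : E ⊆ R
    E⊆R x∈E = x∉p⇒x∈∁p λ x∈ → x∈p⇒x∉∁p ([ Z⊆X ∘ A⊆Z , V⊆X ]′ (x∈p∪q⁻ A V x∈)) (E⊆∁X x∈E)

    m+j≤∣R∣ : m + j ≤ ∣ R ∣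
    m+j≤∣R∣ = +-cancelʳ-≤ n _ _ (begin
      m + j + n                                ≡⟨ rearrange m j n ⟩
      n + m + j                                ≤⟨ +-monoˡ-≤ j (n≤∣∁p∣+∣p∣ (A ∪ V)) ⟩
      ∣ R ∣ + ∣ A ∪ V ∣ + j                    ≡⟨ +-assoc ∣ R ∣ _ j ⟩
      ∣ R ∣ + (∣ A ∪ V ∣ + j)                  ≤⟨ +-monoʳ-≤ ∣ R ∣ (+-monoˡ-≤ j (∣p∪q∣≤∣p∣+∣q∣ A V)) ⟩
      ∣ R ∣ + (∣ A ∣ + ∣ V ∣ + j)              ≡⟨ cong (∣ R ∣ +_) (swap ∣ A ∣ ∣ V ∣ j) ⟩
      ∣ R ∣ + (∣ V ∣ + (∣ A ∣ + j))            ≤⟨ +-monoʳ-≤ ∣ R ∣ (+-monoʳ-≤ ∣ V ∣ ∣A∣+j≤∣Z∣) ⟩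
      ∣ R ∣ + (∣ V ∣ + ∣ Z ∣)                  ≤⟨ +-monoʳ-≤ ∣ R ∣ (p⊆q⇒∣q─p∣+∣p∣≤∣q∣ Z⊆X) ⟩
      ∣ R ∣ + ∣ X ∣                            ≡⟨ cong (∣ R ∣ +_) ∣X∣≡n ⟩
      ∣ R ∣ + n                                ∎)
      where
      rearrange : ∀ m j n → m + j + n ≡ n + m + j
      rearrange = solve-∀
      swap : ∀ a v j → a + v + j ≡ v + (a + j)
      swap = solve-∀

    m≤3j+ : ∀ {e} → ∣ E ∣ ≤ e → m ≤ 3 * j + e
    m≤3j+ ∣E∣≤e = ≤-trans m≤∣∁X∣ (≤-trans ∣∁X∣≤ (≤-trans (≤-reflexive (cong (_+ (3 * j + ∣ E ∣)) (∣⊥∣≡0 N′)))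
      (+-monoʳ-≤ (3 * j) ∣E∣≤e)))

    enough : ∀ {k j′} → n + k ≤ m + j′ → j′ ≤ j → n + k ≤ ∣ R ∣
    enough n+k≤ j′≤j = ≤-trans n+k≤ (≤-trans (+-monoʳ-≤ m j′≤j) m+j≤∣R∣)

    split : Dec (2 ≤ ∣ E ∣) → False
    split (no 2≰∣E∣) = inside-interval regime
      where
      n+k≤∣R∣ : n + k ≤ ∣ R ∣
      n+k≤∣R∣ = enough n+k≤ (quotient-≤ {e = 1} 3j₁≤ (m≤3j+ (≤-pred (≰⇒> 2≰∣E∣))) (s≤s z≤n))

      -- The bounds 4 and 7 on `k` are `ρ + 2` in the two regimes.
      inside-interval : u + u + 3 ≤ k ⊎ 7 ≤ k × u + u + 2 ≤ k × n < u + u + u → False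
      inside-interval (inj₁ 2u+3≤k) =
        interior avoids interval R R∥A R∥V {u = u} {d = d} (tight 2u+3≤k) 4≤k 3d+2≤k n< n+k≤∣R∣
      inside-interval (inj₂ (7≤k , 2u+2≤k , n<3u)) =
        interior avoids interval R R∥A R∥V {u = u} {d = d} (loose 2u+2≤k n<3u) 7≤k 3d+2≤k n< n+k≤∣R∣
    split (yes 2≤∣E∣) =
      PairedTop.pairedTop avoids interval R R∥A R∥V (E⊆R e₁∈E) (E⊆R e₂∈E) e₁≢e₂
        (red′ (⁅⁆⊆ e₁∈E)) (red′ (⁅⁆⊆ e₂∈E)) (red′ (∪-lub _ _ (⁅⁆⊆ e₁∈E) (⁅⁆⊆ e₂∈E)))
        2u′+3≤k′ n+2≤ (enough n+k′≤ (quotient-≤ {e = 0} (≤-trans 3j₂≤ (≤-reflexive (sym (+-identityʳ m)))) (m≤3j+ ∣E∣≤2) z≤n))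
      where
      first : Nonempty E
      first = nonempty E (≤-trans (n≤1+n 1) 2≤∣E∣)

      e₁ : Fin N′
      e₁ = proj₁ first

      e₁∈E : e₁ ∈ E
      e₁∈E = proj₂ first

      second : Nonempty (E - e₁)
      second = nonempty (E - e₁) (∣p-x∣≥ E e₁ 2≤∣E∣)

      e₂ : Fin N′
      e₂ = proj₁ second

      e₂∈E : e₂ ∈ E
      e₂∈E = proj₁ (∈-removeʳ (proj₂ second))

      e₁≢e₂ : e₁ ≢ e₂
      e₁≢e₂ = proj₂ (∈-removeʳ {p = E} (proj₂ second))

-- Decidability

allSubsets? : ∀ {P : Subset N → Set} → (∀ s → Dec (P s)) → Dec (∀ s → P s)
allSubsets? P? with anySubset? (λ s → ¬? (P? s))
... | yes (s , ¬p) = no λ all → ¬p (all s)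
... | no  none     = yes λ s → decidable-stable (P? s) λ ¬p → none (s , ¬p)

-- A map on `Subset (suc k)` is a pair of maps on `Subset k`. Since the maps rebuilt from such pairs
-- agree with the given ones only pointwise, `P` has to respect pointwise equality.
anyMap? : ∀ k {P : (Subset k → Subset N) → Set} → (∀ {f g} → (∀ v → f v ≡ g v) → P f → P g) →
  (∀ f → Dec (P f)) → Dec (∃ P)
anyMap? zero resp P? = map′ (λ (s , p) → (λ _ → s) , p) (λ (f , p) → f [] , resp (λ { [] → refl }) p)
  (anySubset? λ s → P? λ _ → s)
anyMap? {N} (suc k) {P} resp P? = map′
  (λ (f , g , p) → join f g , p)
  (λ (h , p) → h ∘ (outside ∷_) , h ∘ (inside ∷_) ,
    resp (λ { (outside ∷ v) → refl ; (inside ∷ v) → refl }) p)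
  (anyMap? k
    (λ f≗f′ (g , p) → g , resp (λ { (outside ∷ v) → f≗f′ v ; (inside ∷ v) → refl }) p)
    (λ f → anyMap? k (λ g≗g′ → resp λ { (outside ∷ v) → refl ; (inside ∷ v) → g≗g′ v }) (λ g → P? (join f g))))
  where
  join : (Subset k → Subset N) → (Subset k → Subset N) → Subset (suc k) → Subset N
  join f g (outside ∷ v) = f v
  join f g (inside  ∷ v) = g v

monoCopy? : ∀ (c : Coloring N) b k → Dec (MonoCopy c b k)
monoCopy? c b k = anyMap? k
  (λ f≗g (isCopy , colour) →
      (λ v w → subst₂ (λ s t → (v ⊆ w → s ⊆ t) × (s ⊆ t → v ⊆ w)) (f≗g v) (f≗g w) (isCopy v w))
    , (λ v → trans (cong c (sym (f≗g v))) (colour v)))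
  (λ f → allSubsets? (λ v → allSubsets? λ w →
           ((v ⊆? w) →-dec (f v ⊆? f w)) ×-dec ((f v ⊆? f w) →-dec (v ⊆? w)))
         ×-dec allSubsets? (λ v → c (f v) ≟ᵇ b))

-- The argument so far only refutes avoidance; deciding whether the copies exist turns this into a
-- choice between them.
unavoidable⇒Ramsey : (∀ (c : Coloring N) → ¬ Avoids n c) → RamseyProperty 3 n N
unavoidable⇒Ramsey {N} {n} ¬avoids c = decide (monoCopy? c true 3) (monoCopy? c false n)
  where
  decide : Dec (MonoCopy c true 3) → Dec (MonoCopy c false n) → MonoCopy c true 3 ⊎ MonoCopy c false n
  decide (yes red) _          = inj₁ red
  decide (no  _)   (yes blue) = inj₂ blue
  decide (no ¬red) (no ¬blue) = contradiction (¬red , ¬blue) (¬avoids c)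

-- Here the colours change roles: `gap` tries to embed a red `Q₃` with one spare element. Its
-- failure leaves a blue `A` and a blue `Z ∪ ⁅ zero ⁆` above it, a blue `Q₁`.
unavoidable₁ : ∀ (c : Coloring 4) → ¬ Avoids 1 c
unavoidable₁ c (noRed , noBlue) =
  conclude (gap (not ∘ c) (λ (f , isCopy , colour) → noRed (f , isCopy , not-injective ∘ colour))
    X ≤-refl C C-mono X∥C 1 id)
  where
  X : Subset 4
  X = outside ∷ ⊤

  C : ℕ → Subset 4
  C zero    = ⊥
  C (suc _) = ⁅ zero ⁆

  C-mono : ∀ {i j} → i ≤ j → C i ⊆ C j
  C-mono z≤n     x∈ = contradiction x∈ ∉⊥
  C-mono (s≤s _) x∈ = x∈

  X∥C : ∀ i → Disjoint X (C i)
  X∥C zero    _          x∈        = ∉⊥ x∈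
  X∥C (suc i) (there x∈) (there y∈) = ∉⊥ y∈

  pair : Subset 4 → Subset 4 → Subset 1 → Subset 4
  pair A Z (outside ∷ []) = A
  pair A Z (inside  ∷ []) = Z ∪ ⁅ zero ⁆

  isCopy : ∀ {A Z} → A ⊆ X → A ⊆ Z → IsCopy (pair A Z)
  isCopy A⊆X A⊆Z (outside ∷ []) (outside ∷ []) = (λ _ → id) , (λ _ → id)
  isCopy A⊆X A⊆Z (inside  ∷ []) (inside  ∷ []) = (λ _ → id) , (λ _ → id)
  isCopy {A} {Z} A⊆X A⊆Z (outside ∷ []) (inside ∷ []) = (λ _ → p⊆p∪q ⁅ zero ⁆ ∘ A⊆Z) , λ { _ (there ()) }
  isCopy {A} {Z} A⊆X A⊆Z (inside ∷ []) (outside ∷ []) = (λ v⊆w → contradiction (v⊆w here) λ ())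
    , λ sub → contradiction (A⊆X (sub (q⊆p∪q Z ⁅ zero ⁆ here))) λ ()

  conclude : ¬ Gap (not ∘ c) X C
  conclude (j , A , Z , A⊆Z , Z⊆X , _ , redA , red) = noBlue (pair A Z , isCopy (Z⊆X ∘ A⊆Z) A⊆Z
    , λ { (outside ∷ []) → not-injective (subst (λ s → not (c s) ≡ true) (∪-identityʳ A) redA)
        ; (inside ∷ []) → not-injective (red ⁅ zero ⁆ (C-mono (n≤1+n j)) id) })

-- Arithmetic

fits? : ∀ n m k u d j₁ k′ u′ j₂ → Dec (Fits n m k u d j₁ k′ u′ j₂)
fits? n m k u d j₁ k′ u′ j₂ =
  (_ ≤? _) ×-dec (_ ≤? _) ×-dec (_ ≤? _) ×-dec (_ ≤? _) ×-dec (_ ≤? _) ×-dec (_ <? _) ×-dec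
  ((_ ≤? _) ⊎-dec ((_ ≤? _) ×-dec (_ ≤? _) ×-dec (_ <? _))) ×-dec
  (_ ≤? _) ×-dec (_ ≤? _) ×-dec (_ ≤? _) ×-dec (_ ≤? _)

Budget : ℕ → Set
Budget n = ∃[ m ] ∃[ k ] ∃[ u ] ∃[ d ] ∃[ j₁ ] ∃[ k′ ] ∃[ u′ ] ∃[ j₂ ] Fits n m k u d j₁ k′ u′ j₂

-- Each parameter is the largest that an upper bound in `Fits` allows given the earlier ones; the
-- sixteen cases are verified by evaluation.
smallBudget : ∀ (r : Fin 16) → Budget (2 + toℕ r)
smallBudget r = M x , K x , U x , D x , J₁ x , K′ x , U′ x , J₂ x , from-yes (all? computed?) r
  where
  x : ℕ
  x = 2 + toℕ r

  M J₁ K U D J₂ K′ U′ : ℕ → ℕ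
  M  y = (37 * y + 39) / 16 ∸ y
  J₁ y = (M y + 1) / 3
  K  y = M y + J₁ y ∸ y
  -- For odd `K y` the rounding gives the tight regime, for even `K y` the loose one.
  U  y = (K y ∸ 2) / 2
  D  y = (K y ∸ 2) / 3
  J₂ y = M y / 3
  K′ y = M y + J₂ y ∸ y
  U′ y = (K′ y ∸ 3) / 2

  computed? : ∀ (r : Fin 16) → let y = 2 + toℕ r in
    Dec (Fits y (M y) (K y) (U y) (D y) (J₁ y) (K′ y) (U′ y) (J₂ y))
  computed? r = fits? y (M y) (K y) (U y) (D y) (J₁ y) (K′ y) (U′ y) (J₂ y)
    where
    y : ℕ
    y = 2 + toℕ r

shift : ∀ {x y x′ y′} a → x ≤ y → x′ ≡ a + x → a + y ≡ y′ → x′ ≤ y′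
shift a x≤y refl refl = +-monoʳ-≤ a x≤y

-- The increments match the slopes: `37 = 16 + 21`, `21 = 3 * 7`, `21 + 7 = 16 + 12`,
-- `12 = 2 * 6 = 3 * 4` up to rounding constants. Apart from the constant bounds on `k`, the
-- inequalities are translated, and `n < u + u + u` and `n + 2 ≤ k′ + u′` even gain 2.
budget-step : Budget n → Budget (16 + n)
budget-step {n} (m , k , u , d , j₁ , k′ , u′ , j₂ , f₁ , f₂ , f₃ , f₄ , f₅ , f₆ , f₇ , f₈ , f₉ , f₁₀ , f₁₁) =
  21 + m , 12 + k , 6 + u , 4 + d , 7 + j₁ , 12 + k′ , 6 + u′ , 7 + j₂ ,
  shift 592 f₁ (e₁ n m) (e₂ n) ,
  shift 21 f₂ (e₃ j₁) refl ,
  shift 28 f₃ (e₄ n k) (e₅ m j₁) ,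
  ≤-trans f₄ (m≤n+m k 12) ,
  shift 12 f₅ (e₆ d) refl ,
  shift 16 f₆ (+-suc 16 n) (e₇ u d) ,
  [ (λ f → inj₁ (shift 12 f (e₈ u 3) refl))
  , (λ (f , f′ , f″) → inj₂ (≤-trans f (m≤n+m k 12) , shift 12 f′ (e₈ u 2) refl
      , ≤-trans (shift 16 f″ (+-suc 16 n) refl) (≤-trans (m≤n+m _ 2) (≤-reflexive (e₉ u))))) ]′ f₇ ,
  shift 21 f₈ (e₃ j₂) refl ,
  shift 28 f₉ (e₄ n k′) (e₅ m j₂) ,
  shift 12 f₁₀ (e₈ u′ 3) refl ,
  ≤-trans (shift 16 f₁₁ refl refl) (≤-trans (m≤n+m _ 2) (≤-reflexive (e₁₀ k′ u′)))
  where
  e₁ : ∀ n m → 16 * ((16 + n) + (21 + m)) ≡ 592 + 16 * (n + m)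
  e₁ = solve-∀
  e₂ : ∀ n → 592 + (37 * n + 39) ≡ 37 * (16 + n) + 39
  e₂ = solve-∀
  e₃ : ∀ j → 3 * (7 + j) ≡ 21 + 3 * j
  e₃ = solve-∀
  e₄ : ∀ n k → (16 + n) + (12 + k) ≡ 28 + (n + k)
  e₄ = solve-∀
  e₅ : ∀ m j → 28 + (m + j) ≡ (21 + m) + (7 + j)
  e₅ = solve-∀
  e₆ : ∀ d → 3 * (4 + d) + 2 ≡ 12 + (3 * d + 2)
  e₆ = solve-∀
  e₇ : ∀ u d → 16 + (u + u + 2 + d) ≡ (6 + u) + (6 + u) + 2 + (4 + d)
  e₇ = solve-∀
  e₈ : ∀ u i → (6 + u) + (6 + u) + i ≡ 12 + (u + u + i)
  e₈ = solve-∀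
  e₉ : ∀ u → 2 + (16 + (u + u + u)) ≡ (6 + u) + (6 + u) + (6 + u)
  e₉ = solve-∀
  e₁₀ : ∀ k u → 2 + (16 + (k + u)) ≡ (12 + k) + (6 + u)
  e₁₀ = solve-∀

budget : ∀ n → Budget (2 + n)
budget n with n divMod 16
... | result q r n≡r+q*16 = subst Budget (trans (rearrange (toℕ r) (q * 16)) (cong (2 +_) (sym n≡r+q*16))) (iterate q)
  where
  rearrange : ∀ r s → s + (2 + r) ≡ 2 + (r + s)
  rearrange = solve-∀

  iterate : ∀ q → Budget (q * 16 + (2 + toℕ r))
  iterate zero    = smallBudget r
  iterate (suc q) = budget-step (iterate q)

theorem6 : (n : ℕ) → 1 ≤ n →
    Σ ℕ (λ N → (16 * N ≤ 37 * n + 39) × RamseyProperty 3 n N)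
-- There is no budget for `n = 1`: `m ≤ 3` and `j₁ ≤ 1` leave only `k ≤ 3`.
theorem6 (suc zero)    _ = 4 , m≤m+n 64 12 , unavoidable⇒Ramsey unavoidable₁
theorem6 (suc (suc n)) _ with budget n
... | m , _ , u , d , _ , _ , _ , _ , fits =
  2 + n + m , proj₁ fits , unavoidable⇒Ramsey (unavoidable (2 + n) m {u = u} {d = d} fits)
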